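{- Let $p$ be an odd prime, $l>1$ an integer, $n=p^l$ and $m=\phi(n)$. Then $$\mathrm{Cond}(V_{\Phi_n})\le 4(p-1)m.$$
   Context: $\phi$ is Euler's totient, $\Phi_n$ is the $n$-th cyclotomic polynomial, of degree $m=\phi(n)$, and $\zeta_1,\dots,\zeta_m\in\mathbb{C}$ are the primitive $n$-th roots of unity (in any fixed order). $V_{\Phi_n}$ is the $m\times m$ Vandermonde matrix whose $(i,j)$ entry is $\zeta_i^{\,j-1}$, $1\le i,j\le m$. For a complex matrix $A=(a_{ij})$, $\|A\|=\sqrt{\sum_{i,j}|a_{ij}|^2}$ is the Frobenius norm, and for invertible $A$, $\mathrm{Cond}(A)=\|A\|\,\|A^{ -1}\|$. -}

module Defs where

open import Algebra.Bundles.Raw using (RawRing)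
import Algebra.Definitions.RawSemiring as RawSemiringDefs
open import Data.Bool.Base using (if_then_else_)
open import Data.Empty using (⊥-elim)
open import Data.Fin.Base using (toℕ)
open import Data.Fin.Properties as Fin using ()
open import Data.Integer.Base as ℤ using (+_)
import Data.Integer.DivMod as ℤ
import Data.Integer.Properties as ℤ
open import Data.List.Base using (length; filter; map; upTo)
open import Data.Nat.Base as ℕ using (ℕ; zero; suc)
open import Data.Nat.Coprimality using (coprime?)
import Data.Nat.Properties as ℕ
open import Data.Product.Base using (∃; _×_; _,_)
open import Data.Rational.Base as ℚ using (ℚ; 0ℚ; 1ℚ; ½; mkℚ; *≤*; *<*; ↥_; ↧_; ↧ₙ_)
import Data.Rational.Properties as ℚ
open import Data.Rational.Solver using (module +-*-Solver)
import Data.Rational.Unnormalised.Base as ℚᵘ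
import Data.Rational.Unnormalised.Properties as ℚᵘ
open import Data.Sum.Base using (inj₁; inj₂)
open import Data.Vec.Functional using (Vector)
open import Function.Definitions using (Injective)
open import Level using (0ℓ)
open import Relation.Binary.PropositionalEquality
open import Relation.Nullary using (¬_; yes; no; does)

open +-*-Solver using (solve; _:+_; _:*_; :-_; _:-_; _:=_)

∣-∣≤ : ∀ {p q ε} → p ℚ.≤ q ℚ.+ ε → q ℚ.≤ p ℚ.+ ε → ℚ.∣ p ℚ.- q ∣ ℚ.≤ ε
∣-∣≤ {p} {q} {ε} p≤ q≤ with ℚ.∣p∣≡p∨∣p∣≡-p (p ℚ.- q)
... | inj₁ eq = subst₂ ℚ._≤_ (sym eq)
      (solve 2 (λ b c → b :+ c :+ :- b := c) refl q ε)
      (ℚ.+-monoˡ-≤ (ℚ.- q) p≤)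
... | inj₂ eq = subst₂ ℚ._≤_
      (trans (solve 2 (λ a b → b :+ :- a := :- (a :- b)) refl p q) (sym eq))
      (solve 2 (λ a c → a :+ c :+ :- a := c) refl p ε)
      (ℚ.+-monoˡ-≤ (ℚ.- p) q≤)

p≤∣p∣ : ∀ p → p ℚ.≤ ℚ.∣ p ∣
p≤∣p∣ p with ℚ.≤-total 0ℚ p
... | inj₁ 0≤p = ℚ.≤-reflexive (sym (ℚ.0≤p⇒∣p∣≡p 0≤p))
... | inj₂ p≤0 = ℚ.≤-trans p≤0 (ℚ.0≤∣p∣ p)

p≤q+∣p-q∣ : ∀ p q → p ℚ.≤ q ℚ.+ ℚ.∣ p ℚ.- q ∣
p≤q+∣p-q∣ p q = subst (ℚ._≤ q ℚ.+ ℚ.∣ p ℚ.- q ∣)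
  (solve 2 (λ a b → b :+ (a :- b) := a) refl p q)
  (ℚ.+-monoʳ-≤ q (p≤∣p∣ (p ℚ.- q)))

*-mono-≤ : ∀ {p q r s} → 0ℚ ℚ.≤ r → 0ℚ ℚ.≤ q → p ℚ.≤ q → r ℚ.≤ s →
           p ℚ.* r ℚ.≤ q ℚ.* s
*-mono-≤ {p} {q} {r} {s} 0≤r 0≤q p≤q r≤s = ℚ.≤-trans
  (ℚ.*-monoʳ-≤-nonNeg r {{ℚ.nonNegative 0≤r}} p≤q)
  (ℚ.*-monoˡ-≤-nonNeg q {{ℚ.nonNegative 0≤q}} r≤s)

*-pos : ∀ {p q} → 0ℚ ℚ.< p → 0ℚ ℚ.< q → 0ℚ ℚ.< p ℚ.* q
*-pos {p} {q} 0<p 0<q =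
  ℚ.positive⁻¹ (p ℚ.* q) {{ℚ.pos*pos⇒pos p {{ℚ.positive 0<p}} q {{ℚ.positive 0<q}}}}

½+½ : ∀ ε → ½ ℚ.* ε ℚ.+ ½ ℚ.* ε ≡ ε
½+½ ε = trans (sym (ℚ.*-distribʳ-+ ε ½ ½)) (ℚ.*-identityˡ ε)

0<½* : ∀ {ε} → 0ℚ ℚ.< ε → 0ℚ ℚ.< ½ ℚ.* ε
0<½* = *-pos (ℚ.positive⁻¹ ½)

fromℕℚ : ℕ → ℚ
fromℕℚ n = + n ℚ./ 1

toℚᵘ-/ : ∀ i d → ℚ.toℚᵘ (i ℚ./ suc d) ℚᵘ.≃ ℚᵘ.mkℚᵘ i d
toℚᵘ-/ i d = ℚ.toℚᵘ-fromℚᵘ (ℚᵘ.mkℚᵘ i d)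

/1-mono-≤ : ∀ {i j} → i ℤ.≤ j → i ℚ./ 1 ℚ.≤ j ℚ./ 1
/1-mono-≤ {i} {j} i≤j = ℚ.toℚᵘ-cancel-≤
  (ℚᵘ.≤-trans (ℚᵘ.≤-reflexive (toℚᵘ-/ i 0))
  (ℚᵘ.≤-trans (ℚᵘ.*≤* (ℤ.*-monoʳ-≤-nonNeg (+ 1) i≤j))
              (ℚᵘ.≤-reflexive (ℚᵘ.≃-sym (toℚᵘ-/ j 0)))))

fromℕ-* : ∀ a b → fromℕℚ (a ℕ.* b) ≡ fromℕℚ a ℚ.* fromℕℚ b
fromℕ-* a b = ℚ.toℚᵘ-injective (ℚᵘ.≃-trans (toℚᵘ-/ (+ (a ℕ.* b)) 0)
  (ℚᵘ.≃-trans (ℚᵘ.*≡* (cong (ℤ._* + 1) (ℤ.pos-* a b)))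
  (ℚᵘ.≃-sym (ℚᵘ.≃-trans (ℚ.toℚᵘ-homo-* (fromℕℚ a) (fromℕℚ b))
    (ℚᵘ.*-cong (toℚᵘ-/ (+ a) 0) (toℚᵘ-/ (+ b) 0))))))

fromℕ-suc : ∀ a → fromℕℚ (suc a) ≡ fromℕℚ a ℚ.+ 1ℚ
fromℕ-suc a = ℚ.toℚᵘ-injective (ℚᵘ.≃-trans (toℚᵘ-/ (+ suc a) 0)
  (ℚᵘ.≃-trans (ℚᵘ.*≡* (cong (ℤ._* + 1) eq))
  (ℚᵘ.≃-sym (ℚᵘ.≃-trans (ℚ.toℚᵘ-homo-+ (fromℕℚ a) 1ℚ)
    (ℚᵘ.+-cong (toℚᵘ-/ (+ a) 0) (ℚᵘ.≃-refl {ℚ.toℚᵘ 1ℚ}))))))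
  where
  eq : + suc a ≡ + a ℤ.* + 1 ℤ.+ + 1 ℤ.* + 1
  eq = trans (cong +_ (ℕ.+-comm 1 a)) (cong (ℤ._+ + 1) (sym (ℤ.*-identityʳ (+ a))))

recip : ℕ → ℚ
recip n = + 1 ℚ./ suc n

recip-inverse : ∀ n → fromℕℚ (suc n) ℚ.* recip n ≡ 1ℚ
recip-inverse n = ℚ.toℚᵘ-injective
  (ℚᵘ.≃-trans (ℚ.toℚᵘ-homo-* (fromℕℚ (suc n)) (recip n))
  (ℚᵘ.≃-trans (ℚᵘ.*-cong (toℚᵘ-/ (+ suc n) 0) (toℚᵘ-/ (+ 1) n))
    (ℚᵘ.*≡* (cong +_ (trans
      (trans (ℕ.*-identityʳ (suc n ℕ.* 1)) (ℕ.*-identityʳ (suc n)))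
      (sym (trans (ℕ.*-identityˡ (1 ℕ.* suc n)) (ℕ.*-identityˡ (suc n)))))))))

0≤recip : ∀ n → 0ℚ ℚ.≤ recip n
0≤recip n = ℚ.nonNegative⁻¹ (recip n) {{ℚ.normalize-nonNeg 1 (suc n)}}

archimedean : ∀ ε → 0ℚ ℚ.< ε → ∀ n → ↧ₙ ε ℕ.≤ n → recip n ℚ.≤ ε
archimedean (mkℚ (+ zero) d c) (*<* (ℤ.+<+ ())) n b≤n
archimedean ε@(mkℚ (+ suc a) d c) 0<ε n b≤n = ℚ.toℚᵘ-cancel-≤
  (ℚᵘ.≤-trans (ℚᵘ.≤-reflexive (toℚᵘ-/ (+ 1) n))
    (ℚᵘ.*≤* (ℤ.+≤+ (ℕ.≤-trans
      (ℕ.≤-trans (ℕ.≤-reflexive (ℕ.*-identityˡ (suc d))) (ℕ.≤-trans b≤n (ℕ.n≤1+n n)))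
      (ℕ.m≤n*m (suc n) (suc a))))))
archimedean (mkℚ (ℤ.-[1+ a ]) d c) (*<* ()) n b≤n

floor-≤ : ∀ q → ℚ.floor q ℚ./ 1 ℚ.≤ q
floor-≤ q@record{} = ℚ.toℚᵘ-cancel-≤
  (ℚᵘ.≤-trans (ℚᵘ.≤-reflexive (toℚᵘ-/ (ℚ.floor q) 0))
    (ℚᵘ.*≤* (subst (ℚ.floor q ℤ.* ↧ q ℤ.≤_) (sym (ℤ.*-identityʳ (↥ q)))
      (ℤ.[n/d]*d≤n (↥ q) (↧ q)))))

≤-floor+1 : ∀ q → q ℚ.≤ ℤ.suc (ℚ.floor q) ℚ./ 1
≤-floor+1 q@record{} = ℚ.toℚᵘ-cancel-≤
  (ℚᵘ.≤-trans
    (ℚᵘ.*≤* (ℤ.<⇒≤ (subst₂ ℤ._<_ (sym (ℤ.*-identityʳ (↥ q)))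
       (cong (λ z → ℤ.suc z ℤ.* ↧ q) (sym (ℤ.div-pos-is-/ℕ (↥ q) (↧ₙ q))))
       (ℤ.n<s[n/ℕd]*d (↥ q) (↧ₙ q)))))
    (ℚᵘ.≤-reflexive (ℚᵘ.≃-sym (toℚᵘ-/ (ℤ.suc (ℚ.floor q)) 0))))

0≤floor : ∀ q → 0ℚ ℚ.≤ q → + 0 ℤ.≤ ℚ.floor q
0≤floor q@(mkℚ (+ a) d c) 0≤q =
  subst (+ 0 ℤ.≤_) (sym (ℤ.div-pos-is-/ℕ (+ a) (suc d))) (ℤ.+≤+ ℕ.z≤n)
0≤floor (mkℚ (ℤ.-[1+ a ]) d c) (*≤* ())

isqrt : ℕ → ℕ
isqrt zero    = 0
isqrt (suc k) with suc (isqrt k) ℕ.* suc (isqrt k) ℕ.≤? suc k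
... | yes _ = suc (isqrt k)
... | no  _ = isqrt k

isqrt-lower : ∀ k → isqrt k ℕ.* isqrt k ℕ.≤ k
isqrt-lower zero = ℕ.z≤n
isqrt-lower (suc k) with suc (isqrt k) ℕ.* suc (isqrt k) ℕ.≤? suc k
... | yes p = p
... | no  _ = ℕ.m≤n⇒m≤1+n (isqrt-lower k)

isqrt-upper : ∀ k → k ℕ.< suc (isqrt k) ℕ.* suc (isqrt k)
isqrt-upper zero = ℕ.s≤s ℕ.z≤n
isqrt-upper (suc k) with suc (isqrt k) ℕ.* suc (isqrt k) ℕ.≤? suc k
... | yes _ = ℕ.≤-<-trans (isqrt-upper k)
                (ℕ.*-mono-< (ℕ.n<1+n (suc (isqrt k))) (ℕ.n<1+n (suc (isqrt k))))
... | no ¬p = ℕ.≰⇒> ¬p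

-- √(max(q, 0)) rounded down to a multiple of 1/(n+1).
sqrtℚ : ℕ → ℚ → ℚ
sqrtℚ n q =
  fromℕℚ (isqrt ℤ.∣ ℚ.floor ((q ℚ.⊔ 0ℚ) ℚ.* fromℕℚ (suc n ℕ.* suc n)) ∣) ℚ.* recip n

0≤fromℕℚ : ∀ k → 0ℚ ℚ.≤ fromℕℚ k
0≤fromℕℚ k = ℚ.nonNegative⁻¹ (fromℕℚ k) {{ℚ.normalize-nonNeg k 1}}

0≤sqrtℚ : ∀ n q → 0ℚ ℚ.≤ sqrtℚ n q
0≤sqrtℚ n q =
  subst (ℚ._≤ sqrtℚ n q) (ℚ.*-zeroˡ 0ℚ)
    (*-mono-≤ ℚ.≤-refl (0≤fromℕℚ r) (0≤fromℕℚ r) (0≤recip n))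
  where r = isqrt ℤ.∣ ℚ.floor ((q ℚ.⊔ 0ℚ) ℚ.* fromℕℚ (suc n ℕ.* suc n)) ∣

module _ (n : ℕ) (q : ℚ) where
  private
    q⁺ = q ℚ.⊔ 0ℚ
    N  = fromℕℚ (suc n)
    δ  = recip n
    y  = q⁺ ℚ.* fromℕℚ (suc n ℕ.* suc n)
    k  = ℤ.∣ ℚ.floor y ∣
    r  = isqrt k
    s  = sqrtℚ n q

    0≤y : 0ℚ ℚ.≤ y
    0≤y = *-mono-≤ {p = 0ℚ} {r = 0ℚ} ℚ.≤-refl (ℚ.p≤q⊔p q 0ℚ) (ℚ.p≤q⊔p q 0ℚ)
            (0≤fromℕℚ (suc n ℕ.* suc n))

    k≡ : + k ≡ ℚ.floor y
    k≡ = ℤ.0≤i⇒+∣i∣≡i (0≤floor y 0≤y)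

    rr≤y : fromℕℚ r ℚ.* fromℕℚ r ℚ.≤ y
    rr≤y = ℚ.≤-trans (ℚ.≤-reflexive (sym (fromℕ-* r r)))
      (ℚ.≤-trans (/1-mono-≤ (ℤ.+≤+ (isqrt-lower k)))
      (subst (λ z → z ℚ./ 1 ℚ.≤ y) (sym k≡) (floor-≤ y)))

    y≤rr : y ℚ.≤ (fromℕℚ r ℚ.+ 1ℚ) ℚ.* (fromℕℚ r ℚ.+ 1ℚ)
    y≤rr = ℚ.≤-trans
      (subst (λ z → y ℚ.≤ ℤ.suc z ℚ./ 1) (sym k≡) (≤-floor+1 y))
      (ℚ.≤-trans (/1-mono-≤ (ℤ.+≤+ (isqrt-upper k)))
      (ℚ.≤-reflexive (trans (fromℕ-* (suc r) (suc r))
        (cong₂ ℚ._*_ (fromℕ-suc r) (fromℕ-suc r)))))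

    yδδ : y ℚ.* (δ ℚ.* δ) ≡ q⁺
    yδδ = begin
      q⁺ ℚ.* fromℕℚ (suc n ℕ.* suc n) ℚ.* (δ ℚ.* δ)
        ≡⟨ cong (λ z → q⁺ ℚ.* z ℚ.* (δ ℚ.* δ)) (fromℕ-* (suc n) (suc n)) ⟩
      q⁺ ℚ.* (N ℚ.* N) ℚ.* (δ ℚ.* δ)
        ≡⟨ solve 3 (λ a b c → a :* (b :* b) :* (c :* c) := a :* ((b :* c) :* (b :* c)))
             refl q⁺ N δ ⟩
      q⁺ ℚ.* ((N ℚ.* δ) ℚ.* (N ℚ.* δ))
        ≡⟨ cong (λ z → q⁺ ℚ.* (z ℚ.* z)) (recip-inverse n) ⟩
      q⁺ ℚ.* 1ℚ
        ≡⟨ ℚ.*-identityʳ q⁺ ⟩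
      q⁺ ∎
      where open ≡-Reasoning

    0≤δδ : 0ℚ ℚ.≤ δ ℚ.* δ
    0≤δδ = *-mono-≤ {p = 0ℚ} {r = 0ℚ} ℚ.≤-refl (0≤recip n) (0≤recip n) (0≤recip n)

  sqrtℚ-lower : sqrtℚ n q ℚ.* sqrtℚ n q ℚ.≤ q ℚ.⊔ 0ℚ
  sqrtℚ-lower = subst₂ ℚ._≤_
    (solve 2 (λ a c → a :* a :* (c :* c) := (a :* c) :* (a :* c)) refl (fromℕℚ r) δ)
    yδδ (ℚ.*-monoʳ-≤-nonNeg (δ ℚ.* δ) {{ℚ.nonNegative 0≤δδ}} rr≤y)

  sqrtℚ-upper : q ℚ.⊔ 0ℚ ℚ.≤
    (sqrtℚ n q ℚ.+ recip n) ℚ.* (sqrtℚ n q ℚ.+ recip n)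
  sqrtℚ-upper = subst₂ ℚ._≤_ yδδ
    (trans
      (solve 3 (λ a o c → (a :+ o) :* (a :+ o) :* (c :* c)
                       := (a :* c :+ o :* c) :* (a :* c :+ o :* c))
         refl (fromℕℚ r) 1ℚ δ)
      (cong (λ z → (s ℚ.+ z) ℚ.* (s ℚ.+ z)) (ℚ.*-identityˡ δ)))
    (ℚ.*-monoʳ-≤-nonNeg (δ ℚ.* δ) {{ℚ.nonNegative 0≤δδ}} y≤rr)

IsCauchy : (ℕ → ℚ) → Set
IsCauchy x = ∀ ε → 0ℚ ℚ.< ε → ∃ λ N → ∀ m n → N ℕ.≤ m → N ℕ.≤ n →
             ℚ.∣ x m ℚ.- x n ∣ ℚ.≤ ε

record ℝ : Set where
  constructor mkℝ
  field
    seq    : ℕ → ℚ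
    cauchy : IsCauchy seq

open ℝ public

infix 4 _≃ᴿ_ _≤ᴿ_

record _≃ᴿ_ (x y : ℝ) : Set where
  constructor mk≃
  field
    close : ∀ ε → 0ℚ ℚ.< ε → ∃ λ N → ∀ n → N ℕ.≤ n →
            ℚ.∣ seq x n ℚ.- seq y n ∣ ℚ.≤ ε

-- Order of the limits, hence the slack ε: not an eventual termwise inequality.
record _≤ᴿ_ (x y : ℝ) : Set where
  constructor mk≤
  field
    bound : ∀ ε → 0ℚ ℚ.< ε → ∃ λ N → ∀ n → N ℕ.≤ n →
            seq x n ℚ.≤ seq y n ℚ.+ ε

open _≃ᴿ_ public
open _≤ᴿ_ public

-- The IsCauchy proofs of the operations are abstract because normalising them
-- is expensive.
abstract
  const-cauchy : ∀ q → IsCauchy (λ _ → q)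
  const-cauchy q ε 0<ε = 0 , λ _ _ _ _ →
    subst (ℚ._≤ ε) (cong ℚ.∣_∣ (sym (ℚ.+-inverseʳ q))) (ℚ.<⇒≤ 0<ε)

fromℚ : ℚ → ℝ
fromℚ q = mkℝ (λ _ → q) (const-cauchy q)

fromℕ : ℕ → ℝ
fromℕ n = fromℚ (fromℕℚ n)

infixl 6 _+ᴿ_
infixl 7 _*ᴿ_
infix  8 -ᴿ_

abstract
  +-cauchy : ∀ {x y} → IsCauchy x → IsCauchy y → IsCauchy (λ n → x n ℚ.+ y n)
  +-cauchy {x} {y} cx cy ε 0<ε =
    let (M , hM) = cx (½ ℚ.* ε) (0<½* 0<ε)
        (N , hN) = cy (½ ℚ.* ε) (0<½* 0<ε)
    in M ℕ.⊔ N , λ m n ≤m ≤n →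
      let open ℚ.≤-Reasoning
          a = x m ; b = x n ; c = y m ; d = y n
      in begin
        ℚ.∣ (a ℚ.+ c) ℚ.- (b ℚ.+ d) ∣
          ≡⟨ cong ℚ.∣_∣ (solve 4 (λ a b c d → (a :+ c) :- (b :+ d) := (a :- b) :+ (c :- d))
               refl a b c d) ⟩
        ℚ.∣ (a ℚ.- b) ℚ.+ (c ℚ.- d) ∣
          ≤⟨ ℚ.∣p+q∣≤∣p∣+∣q∣ (a ℚ.- b) (c ℚ.- d) ⟩
        ℚ.∣ a ℚ.- b ∣ ℚ.+ ℚ.∣ c ℚ.- d ∣
          ≤⟨ ℚ.+-mono-≤ (hM m n (ℕ.m⊔n≤o⇒m≤o M N ≤m) (ℕ.m⊔n≤o⇒m≤o M N ≤n))
                        (hN m n (ℕ.m⊔n≤o⇒n≤o M N ≤m) (ℕ.m⊔n≤o⇒n≤o M N ≤n)) ⟩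
        ½ ℚ.* ε ℚ.+ ½ ℚ.* ε
          ≡⟨ ½+½ ε ⟩
        ε ∎

  neg-cauchy : ∀ {x} → IsCauchy x → IsCauchy (λ n → ℚ.- x n)
  neg-cauchy {x} cx ε 0<ε =
    let (M , hM) = cx ε 0<ε
    in M , λ m n ≤m ≤n → subst (ℚ._≤ ε)
      (trans (sym (ℚ.∣-p∣≡∣p∣ (x m ℚ.- x n)))
        (cong ℚ.∣_∣ (solve 2 (λ a b → :- (a :- b) := (:- a) :- (:- b)) refl (x m) (x n))))
      (hM m n ≤m ≤n)

_+ᴿ_ : ℝ → ℝ → ℝ
x +ᴿ y = mkℝ (λ n → seq x n ℚ.+ seq y n) (+-cauchy {seq x} {seq y} (cauchy x) (cauchy y))

-ᴿ_ : ℝ → ℝ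
-ᴿ x = mkℝ (λ n → ℚ.- seq x n) (neg-cauchy {seq x} (cauchy x))

eventuallyBounded : ∀ {x} → IsCauchy x →
                    ∃ λ B → 0ℚ ℚ.< B × ∃ λ N → ∀ n → N ℕ.≤ n → ℚ.∣ x n ∣ ℚ.≤ B
eventuallyBounded {x} cx =
  let (N , h) = cx 1ℚ (ℚ.positive⁻¹ 1ℚ)
      c = x N
  in ℚ.∣ c ∣ ℚ.+ 1ℚ
   , ℚ.+-mono-≤-< (ℚ.0≤∣p∣ c) (ℚ.positive⁻¹ 1ℚ)
   , N , λ n N≤n →
     let open ℚ.≤-Reasoning in begin
       ℚ.∣ x n ∣
         ≡⟨ cong ℚ.∣_∣ (solve 2 (λ a b → a := b :+ (a :- b)) refl (x n) c) ⟩
       ℚ.∣ c ℚ.+ (x n ℚ.- c) ∣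
         ≤⟨ ℚ.∣p+q∣≤∣p∣+∣q∣ c (x n ℚ.- c) ⟩
       ℚ.∣ c ∣ ℚ.+ ℚ.∣ x n ℚ.- c ∣
         ≤⟨ ℚ.+-monoʳ-≤ ℚ.∣ c ∣ (h n N N≤n ℕ.≤-refl) ⟩
       ℚ.∣ c ∣ ℚ.+ 1ℚ ∎

divide : ∀ {K ε} → 0ℚ ℚ.< K → 0ℚ ℚ.< ε → ∃ λ η → 0ℚ ℚ.< η × K ℚ.* η ≡ ε
divide {K} {ε} 0<K 0<ε = ε ℚ.* r , *-pos 0<ε 0<r , (begin
    K ℚ.* (ε ℚ.* r)  ≡⟨ solve 3 (λ k e r → k :* (e :* r) := e :* (k :* r)) refl K ε r ⟩
    ε ℚ.* (K ℚ.* r)  ≡⟨ cong (ε ℚ.*_) (ℚ.*-inverseʳ K {{K≢0}}) ⟩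
    ε ℚ.* 1ℚ         ≡⟨ ℚ.*-identityʳ ε ⟩
    ε                ∎)
  where
  open ≡-Reasoning
  K≢0 : ℚ.NonZero K
  K≢0 = ℚ.pos⇒nonZero K {{ℚ.positive 0<K}}
  r : ℚ
  r = (ℚ.1/ K) {{K≢0}}
  0<r : 0ℚ ℚ.< r
  0<r = ℚ.positive⁻¹ r {{ℚ.1/pos⇒pos K {{ℚ.positive 0<K}}}}

*-step : ∀ {a b c d B C η} → 0ℚ ℚ.< B → 0ℚ ℚ.< C →
         ℚ.∣ a ∣ ℚ.≤ B → ℚ.∣ d ∣ ℚ.≤ C →
         ℚ.∣ a ℚ.- b ∣ ℚ.≤ η → ℚ.∣ c ℚ.- d ∣ ℚ.≤ η →
         ℚ.∣ a ℚ.* c ℚ.- b ℚ.* d ∣ ℚ.≤ (B ℚ.+ C) ℚ.* η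
*-step {a} {b} {c} {d} {B} {C} {η} 0<B 0<C a≤ d≤ ab≤ cd≤ = begin
    ℚ.∣ a ℚ.* c ℚ.- b ℚ.* d ∣
      ≡⟨ cong ℚ.∣_∣ (solve 4 (λ a b c d → a :* c :- b :* d := a :* (c :- d) :+ d :* (a :- b))
           refl a b c d) ⟩
    ℚ.∣ a ℚ.* (c ℚ.- d) ℚ.+ d ℚ.* (a ℚ.- b) ∣
      ≤⟨ ℚ.∣p+q∣≤∣p∣+∣q∣ (a ℚ.* (c ℚ.- d)) (d ℚ.* (a ℚ.- b)) ⟩
    ℚ.∣ a ℚ.* (c ℚ.- d) ∣ ℚ.+ ℚ.∣ d ℚ.* (a ℚ.- b) ∣
      ≡⟨ cong₂ ℚ._+_ (ℚ.∣p*q∣≡∣p∣*∣q∣ a (c ℚ.- d)) (ℚ.∣p*q∣≡∣p∣*∣q∣ d (a ℚ.- b)) ⟩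
    ℚ.∣ a ∣ ℚ.* ℚ.∣ c ℚ.- d ∣ ℚ.+ ℚ.∣ d ∣ ℚ.* ℚ.∣ a ℚ.- b ∣
      ≤⟨ ℚ.+-mono-≤
           (*-mono-≤ (ℚ.0≤∣p∣ (c ℚ.- d)) (ℚ.<⇒≤ 0<B) a≤ cd≤)
           (*-mono-≤ (ℚ.0≤∣p∣ (a ℚ.- b)) (ℚ.<⇒≤ 0<C) d≤ ab≤) ⟩
    B ℚ.* η ℚ.+ C ℚ.* η
      ≡⟨ sym (ℚ.*-distribʳ-+ η B C) ⟩
    (B ℚ.+ C) ℚ.* η ∎
  where open ℚ.≤-Reasoning

abstract
  *-cauchy : ∀ {x y} → IsCauchy x → IsCauchy y → IsCauchy (λ n → x n ℚ.* y n)
  *-cauchy {x} {y} cx cy ε 0<ε =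
    let (B , 0<B , M₁ , hB) = eventuallyBounded cx
        (C , 0<C , M₂ , hC) = eventuallyBounded cy
        (η , 0<η , Kη≡ε)    = divide (ℚ.+-mono-< 0<B 0<C) 0<ε
        (N₁ , hx) = cx η 0<η
        (N₂ , hy) = cy η 0<η
        M = M₁ ℕ.⊔ M₂
        N = N₁ ℕ.⊔ N₂
    in M ℕ.⊔ N , λ m n ≤m ≤n →
      let M≤m = ℕ.m⊔n≤o⇒m≤o M N ≤m
          M≤n = ℕ.m⊔n≤o⇒m≤o M N ≤n
          N≤m = ℕ.m⊔n≤o⇒n≤o M N ≤m
          N≤n = ℕ.m⊔n≤o⇒n≤o M N ≤n
      in subst (ℚ.∣ x m ℚ.* y m ℚ.- x n ℚ.* y n ∣ ℚ.≤_) Kη≡ε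
        (*-step {x m} {x n} {y m} {y n} 0<B 0<C
          (hB m (ℕ.m⊔n≤o⇒m≤o M₁ M₂ M≤m))
          (hC n (ℕ.m⊔n≤o⇒n≤o M₁ M₂ M≤n))
          (hx m n (ℕ.m⊔n≤o⇒m≤o N₁ N₂ N≤m) (ℕ.m⊔n≤o⇒m≤o N₁ N₂ N≤n))
          (hy m n (ℕ.m⊔n≤o⇒n≤o N₁ N₂ N≤m) (ℕ.m⊔n≤o⇒n≤o N₁ N₂ N≤n)))

_*ᴿ_ : ℝ → ℝ → ℝ
x *ᴿ y = mkℝ (λ n → seq x n ℚ.* seq y n) (*-cauchy {seq x} {seq y} (cauchy x) (cauchy y))

sqrt-step : ∀ {a b s t d e} → 0ℚ ℚ.≤ t → 0ℚ ℚ.≤ d → 0ℚ ℚ.< e → d ℚ.≤ e →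
            s ℚ.* s ℚ.≤ a → b ℚ.≤ (t ℚ.+ d) ℚ.* (t ℚ.+ d) →
            a ℚ.≤ b ℚ.+ e ℚ.* e → s ℚ.≤ t ℚ.+ (e ℚ.+ e)
sqrt-step {a} {b} {s} {t} {d} {e} 0≤t 0≤d 0<e d≤e ss≤a b≤ a≤
  with s ℚ.≤? t ℚ.+ (e ℚ.+ e)
... | yes s≤ = s≤
... | no s≰ = ⊥-elim (ℚ.<-irrefl refl (begin-strict
    a
      ≤⟨ a≤ ⟩
    b ℚ.+ e ℚ.* e
      ≤⟨ ℚ.+-monoˡ-≤ (e ℚ.* e) (ℚ.≤-trans b≤
           (*-mono-≤ 0≤t+d 0≤t+e (ℚ.+-monoʳ-≤ t d≤e) (ℚ.+-monoʳ-≤ t d≤e))) ⟩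
    (t ℚ.+ e) ℚ.* (t ℚ.+ e) ℚ.+ e ℚ.* e
      ≡⟨ sym (ℚ.+-identityʳ _) ⟩
    (t ℚ.+ e) ℚ.* (t ℚ.+ e) ℚ.+ e ℚ.* e ℚ.+ 0ℚ
      ≤⟨ ℚ.+-monoʳ-≤ ((t ℚ.+ e) ℚ.* (t ℚ.+ e) ℚ.+ e ℚ.* e) 0≤cross ⟩
    (t ℚ.+ e) ℚ.* (t ℚ.+ e) ℚ.+ e ℚ.* e ℚ.+ (e ℚ.* (t ℚ.+ e) ℚ.+ e ℚ.* (t ℚ.+ e))
      ≡⟨ solve 2 (λ t e → (t :+ e) :* (t :+ e) :+ e :* e
                            :+ (e :* (t :+ e) :+ e :* (t :+ e))
                       := (t :+ (e :+ e)) :* (t :+ (e :+ e))) refl t e ⟩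
    u ℚ.* u
      ≤⟨ ℚ.*-monoˡ-≤-nonNeg u {{ℚ.nonNegative (ℚ.<⇒≤ 0<u)}} (ℚ.<⇒≤ u<s) ⟩
    u ℚ.* s
      <⟨ ℚ.*-monoˡ-<-pos s {{ℚ.positive (ℚ.<-trans 0<u u<s)}} u<s ⟩
    s ℚ.* s
      ≤⟨ ss≤a ⟩
    a ∎))
  where
  open ℚ.≤-Reasoning
  u = t ℚ.+ (e ℚ.+ e)
  u<s = ℚ.≰⇒> s≰
  0<u : 0ℚ ℚ.< u
  0<u = ℚ.+-mono-≤-< 0≤t (ℚ.+-mono-< 0<e 0<e)
  0≤t+d : 0ℚ ℚ.≤ t ℚ.+ d
  0≤t+d = ℚ.+-mono-≤ 0≤t 0≤d
  0≤t+e : 0ℚ ℚ.≤ t ℚ.+ e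
  0≤t+e = ℚ.+-mono-≤ 0≤t (ℚ.<⇒≤ 0<e)
  0≤et : 0ℚ ℚ.≤ e ℚ.* (t ℚ.+ e)
  0≤et = *-mono-≤ {p = 0ℚ} {r = 0ℚ} ℚ.≤-refl (ℚ.<⇒≤ 0<e) (ℚ.<⇒≤ 0<e) 0≤t+e
  0≤cross : 0ℚ ℚ.≤ e ℚ.* (t ℚ.+ e) ℚ.+ e ℚ.* (t ℚ.+ e)
  0≤cross = ℚ.+-mono-≤ 0≤et 0≤et

⊔0-step : ∀ p q {η} → ℚ.∣ p ℚ.- q ∣ ℚ.≤ η → p ℚ.⊔ 0ℚ ℚ.≤ q ℚ.⊔ 0ℚ ℚ.+ η
⊔0-step p q {η} h = ℚ.⊔-lub
  (ℚ.≤-trans (p≤q+∣p-q∣ p q) (ℚ.+-mono-≤ (ℚ.p≤p⊔q q 0ℚ) h))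
  (ℚ.+-mono-≤ (ℚ.p≤q⊔p q 0ℚ) (ℚ.≤-trans (ℚ.0≤∣p∣ (p ℚ.- q)) h))

abstract
  sqrt-cauchy : ∀ {x} → IsCauchy x → IsCauchy (λ n → sqrtℚ n (x n))
  sqrt-cauchy {x} cx ε 0<ε =
    let e   = ½ ℚ.* ε
        0<e = 0<½* 0<ε
        (M , hM) = cx (e ℚ.* e) (*-pos 0<e 0<e)
        step : ∀ m n → M ℕ.⊔ ↧ₙ e ℕ.≤ m → M ℕ.⊔ ↧ₙ e ℕ.≤ n →
               sqrtℚ m (x m) ℚ.≤ sqrtℚ n (x n) ℚ.+ ε
        step m n ≤m ≤n = subst (λ z → sqrtℚ m (x m) ℚ.≤ sqrtℚ n (x n) ℚ.+ z) (½+½ ε)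
          (sqrt-step (0≤sqrtℚ n (x n)) (0≤recip n) 0<e
            (archimedean e 0<e n (ℕ.m⊔n≤o⇒n≤o M (↧ₙ e) ≤n))
            (sqrtℚ-lower m (x m)) (sqrtℚ-upper n (x n))
            (⊔0-step (x m) (x n)
              (hM m n (ℕ.m⊔n≤o⇒m≤o M (↧ₙ e) ≤m) (ℕ.m⊔n≤o⇒m≤o M (↧ₙ e) ≤n))))
    in M ℕ.⊔ ↧ₙ e , λ m n ≤m ≤n → ∣-∣≤ (step m n ≤m ≤n) (step n m ≤n ≤m)

infix 9 √_

-- For negative x this is 0.
√_ : ℝ → ℝ
√ x = mkℝ (λ n → sqrtℚ n (seq x n)) (sqrt-cauchy {seq x} (cauchy x))

ℝ-rawRing : RawRing 0ℓ 0ℓ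
ℝ-rawRing = record
  { Carrier = ℝ
  ; _≈_     = _≃ᴿ_
  ; _+_     = _+ᴿ_
  ; _*_     = _*ᴿ_
  ; -_      = -ᴿ_
  ; 0#      = fromℚ 0ℚ
  ; 1#      = fromℚ 1ℚ
  }

record ℂ : Set where
  constructor _+i_
  field
    re im : ℝ

open ℂ public

infix 4 _≃ᶜ_

record _≃ᶜ_ (z w : ℂ) : Set where
  constructor mk≃ᶜ
  field
    re-≃ : re z ≃ᴿ re w
    im-≃ : im z ≃ᴿ im w

open _≃ᶜ_ public

ℂ-rawRing : RawRing 0ℓ 0ℓ
ℂ-rawRing = record
  { Carrier = ℂ
  ; _≈_     = _≃ᶜ_
  ; _+_     = λ z w → (re z +ᴿ re w) +i (im z +ᴿ im w)
  ; _*_     = λ z w → (re z *ᴿ re w +ᴿ -ᴿ (im z *ᴿ im w))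
                   +i (re z *ᴿ im w +ᴿ im z *ᴿ re w)
  ; -_      = λ z → (-ᴿ re z) +i (-ᴿ im z)
  ; 0#      = fromℚ 0ℚ +i fromℚ 0ℚ
  ; 1#      = fromℚ 1ℚ +i fromℚ 0ℚ
  }

module ℝR = RawSemiringDefs (RawRing.rawSemiring ℝ-rawRing)
module ℂR = RawSemiringDefs (RawRing.rawSemiring ℂ-rawRing)
open RawRing ℂ-rawRing using (_≈_; _*_; 0#; 1#)

∣_∣ : ℂ → ℝ
∣ z ∣ = √ (re z ℝR.^ 2 +ᴿ im z ℝR.^ 2)

Matrix : ℕ → ℕ → Set
Matrix m n = Vector (Vector ℂ n) m

infix 4 _≈ᴹ_
infixl 7 _*ᴹ_

_≈ᴹ_ : ∀ {m n} → Matrix m n → Matrix m n → Set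
A ≈ᴹ B = ∀ i j → A i j ≈ B i j

_*ᴹ_ : ∀ {m n k} → Matrix m n → Matrix n k → Matrix m k
(A *ᴹ B) i j = ℂR.sum λ l → A i l * B l j

1ᴹ : ∀ {m} → Matrix m m
1ᴹ i j = if does (i Fin.≟ j) then 1# else 0#

record Invertible {m} (A : Matrix m m) : Set where
  field
    inverse  : Matrix m m
    inverseˡ : inverse *ᴹ A ≈ᴹ 1ᴹ
    inverseʳ : A *ᴹ inverse ≈ᴹ 1ᴹ

open Invertible public

‖_‖ : ∀ {m n} → Matrix m n → ℝ
‖ A ‖ = √ (ℝR.sum λ i → ℝR.sum λ j → ∣ A i j ∣ ℝR.^ 2)

Cond : ∀ {m} (A : Matrix m m) → Invertible A → ℝ
Cond A A⁻¹ = ‖ A ‖ *ᴿ ‖ inverse A⁻¹ ‖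

φ : ℕ → ℕ
φ n = length (filter (coprime? n) (map suc (upTo n)))

IsPrimitiveRoot : ℕ → ℂ → Set
IsPrimitiveRoot n z =
  z ℂR.^ n ≈ 1# × (∀ k → 0 ℕ.< k → k ℕ.< n → ¬ (z ℂR.^ k ≈ 1#))

record EnumeratesPrimitiveRoots (n : ℕ) {m} (ζ : Vector ℂ m) : Set where
  field
    isPrimitive : ∀ i → IsPrimitiveRoot n (ζ i)
    distinct    : Injective _≡_ _≈_ ζ
    complete    : ∀ z → IsPrimitiveRoot n z → ∃ λ i → z ≈ ζ i

-- Columns are numbered from 0, so the exponent is toℕ j rather than j - 1.
vandermonde : ∀ {m} → Vector ℂ m → Matrix m m
vandermonde ζ i j = ζ i ℂR.^ toℕ j

{-# OPTIONS --safe #-}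

-- Let t = p^(l-1), so that n = pt and m = (p-1)t, and write z̄ for the conjugate of z. The rows of V
-- satisfy Σ_{j<n} (ζᵢ ζ̄ₖ)^j = n δᵢₖ, but V has only the columns j < m. Subtracting from ζ̄ₖ^j the
-- function ζ̄ₖ^(m + (j mod t)), which agrees with it for m ≤ j < n and is t-periodic in j, hence
-- orthogonal to ζᵢ^j because Σ_{b<p} ζᵢ^(tb) = 0, gives the right inverse
--   W_{jk} = (ζ̄ₖ^j - ζ̄ₖ^(m + (j mod t))) / n.
-- It is a left inverse too, as a polynomial of degree < m with m distinct roots vanishes. The entries
-- of V have modulus 1 and those of W at most 2/n, so ‖V‖ ≤ m, ‖V⁻¹‖ ≤ 2 and Cond V ≤ 2m.

module Submission where

open import Defs
open import Algebra.Bundles using (CommutativeRing)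
open import Algebra.Bundles.Raw using (RawRing)
import Algebra.Properties.CommutativeSemiring.Exp as Exp
import Algebra.Properties.Ring as RingProperties
import Algebra.Properties.Semiring.Sum as Sum
open import Data.Bool.Base using (if_then_else_)
open import Data.Fin.Base using (Fin; zero; suc; toℕ)
import Data.Fin.Properties as Fin
import Data.Integer.Base as ℤ
open import Data.List.Base using (length; filter; applyUpTo; upTo; map)
import Data.List.Properties as List
open import Data.Nat.Base as ℕ using (ℕ; zero; suc)
open import Data.Nat.Coprimality as Coprime using (Coprime; coprime?)
open import Data.Nat.Divisibility as ℕ using (_∣_; _∣?_)
import Data.Nat.DivMod as ℕ
open import Data.Nat.Primality using (Prime; prime⇒irreducible; prime⇒nonZero; prime⇒nonTrivial)
import Data.Nat.Properties as ℕ
open import Data.Product.Base using (∃; _×_; _,_; proj₁; proj₂)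
open import Data.Rational.Base as ℚ using (ℚ; 0ℚ; 1ℚ; ½)
import Data.Rational.Properties as ℚ
open import Data.Rational.Solver using (module +-*-Solver)
open import Data.Sum.Base using (inj₁; inj₂)
open import Data.Vec.Functional using (Vector; head; tail)
open import Function.Base using (_∘_; case_of_)
open import Function.Definitions using (Injective)
open import Level using (0ℓ)
open import Relation.Binary.PropositionalEquality as ≡ using (_≡_)
import Relation.Binary.Reasoning.Setoid as SetoidReasoning
open import Relation.Nullary using (¬_; yes; no; does; contradiction)
open import Relation.Nullary.Decidable using (¬?)
open import Relation.Unary using (Pred; Decidable)

open +-*-Solver using (solve; con; _:+_; _:*_; :-_; _:-_; _:=_)

-- Sums, polynomials and matrices over a commutative ring

-- The correction is a reduction modulo Φ_n = 1 + X^t + ... + X^((p-1)t). Column l of the inverse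
-- discrete Fourier matrix is the polynomial (1/n) Σ_{j<n} ζ̄_l^j X^j: its value at ζ_i is 1 or 0 as
-- wanted, but its degree may reach n - 1. The t-periodic coefficient sequences of length n are the
-- multiples R Φ_n with deg R < t. Subtracting the one that matches the coefficients from m on
-- leaves the Lagrange interpolation polynomial of degree below m. The Cauchy reals shape the rest:
-- their equality is not decidable, and no reciprocal of a real or complex number is ever taken. The
-- algebra runs in a commutative ring with a cancellation law as hypothesis. The only reciprocal is
-- the rational 1/n, and the inverse of ζ is its conjugate, which rests on |ζ|² = 1. That in turn is
-- deduced from ζ^n = 1 by cancelling in the reals.

module RingSums {c ℓ} (R : CommutativeRing c ℓ) where
  open CommutativeRing R hiding (zero)
  open Exp commutativeSemiring using (_^_; ^-homo-*; ^-distrib-*; ^-congˡ)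
  open RingProperties ring
  open Sum semiring
  open SetoidReasoning setoid

  -- Summands live on all of ℕ, so that shifting the index and lengthening the range need no
  -- arithmetic in `Fin`.
  ∑< : ℕ → (ℕ → Carrier) → Carrier
  ∑< n f = sum {n} λ i → f (toℕ i)

  ∑<-cong : ∀ n {f g} → (∀ j → j ℕ.< n → f j ≈ g j) → ∑< n f ≈ ∑< n g
  ∑<-cong n f≈g = sum-cong-≋ {n} λ i → f≈g (toℕ i) (Fin.toℕ<n i)

  ∑<-+ : ∀ a b f → ∑< (a ℕ.+ b) f ≈ ∑< a f + ∑< b (λ j → f (a ℕ.+ j))
  ∑<-+ zero    b f = sym (+-identityˡ _)
  ∑<-+ (suc a) b f = begin
    f 0 + ∑< (a ℕ.+ b) (f ∘ suc)                                 ≈⟨ +-congˡ (∑<-+ a b (f ∘ suc)) ⟩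
    f 0 + (∑< a (f ∘ suc) + ∑< b (λ j → f (suc a ℕ.+ j)))  ≈⟨ +-assoc _ _ _ ⟨
    ∑< (suc a) f + ∑< b (λ j → f (suc a ℕ.+ j))             ∎

  ∑<-zero : ∀ n {f} → (∀ j → j ℕ.< n → f j ≈ 0#) → ∑< n f ≈ 0#
  ∑<-zero n f≈0 = trans (∑<-cong n f≈0) (sum-replicate-zero n)

  x≈y⇒x-y≈0 : ∀ {x y} → x ≈ y → x - y ≈ 0#
  x≈y⇒x-y≈0 {x} {y} x≈y = trans (+-congʳ x≈y) (-‿inverseʳ y)

  x-y≈0⇒x≈y : ∀ {x y} → x - y ≈ 0# → x ≈ y
  x-y≈0⇒x≈y = x∙y⁻¹≈ε⇒x≈y _ _

  *-distribˡ-- : ∀ x y z → x * (y - z) ≈ x * y - x * z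
  *-distribˡ-- x y z = trans (distribˡ x y (- z)) (+-congˡ (sym (-‿distribʳ-* x z)))

  *-distribʳ-- : ∀ x y z → (y - z) * x ≈ y * x - z * x
  *-distribʳ-- x y z = trans (distribʳ x y (- z)) (+-congˡ (sym (-‿distribˡ-* z x)))

  1^n≈1 : ∀ n → 1# ^ n ≈ 1#
  1^n≈1 zero    = refl
  1^n≈1 (suc n) = trans (*-identityˡ _) (1^n≈1 n)

  -- Summing over the period {t, …, t+n-1} instead of {0, …, n-1} multiplies the sum by v.
  periodic-sum : ∀ n t v (f : ℕ → Carrier) → (∀ j → f (n ℕ.+ j) ≈ f j) →
                 (∀ j → f (t ℕ.+ j) ≈ v * f j) → ∑< n f * (v - 1#) ≈ 0#
  periodic-sum n t v f f-periodic f-shift = begin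
    ∑< n f * (v - 1#)             ≈⟨ *-distribˡ-- _ _ _ ⟩
    ∑< n f * v - ∑< n f * 1#      ≈⟨ x≈y⇒x-y≈0 (trans (*-comm _ _) (trans shifted (sym (*-identityʳ _)))) ⟩
    0#                            ∎
    where
    shifted : v * ∑< n f ≈ ∑< n f
    shifted = +-cancelˡ (∑< t f) _ _ (begin
      ∑< t f + v * ∑< n f                      ≈⟨ +-congˡ (*-distribˡ-sum {n} v _) ⟩
      ∑< t f + ∑< n (λ j → v * f j)            ≈⟨ +-congˡ (∑<-cong n λ j _ → sym (f-shift j)) ⟩
      ∑< t f + ∑< n (λ j → f (t ℕ.+ j))        ≈⟨ ∑<-+ t n f ⟨
      ∑< (t ℕ.+ n) f                           ≡⟨ ≡.cong (λ k → ∑< k f) (ℕ.+-comm t n) ⟩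
      ∑< (n ℕ.+ t) f                           ≈⟨ ∑<-+ n t f ⟩
      ∑< n f + ∑< t (λ j → f (n ℕ.+ j))        ≈⟨ +-congˡ (∑<-cong t λ j _ → f-periodic j) ⟩
      ∑< n f + ∑< t f                          ≈⟨ +-comm _ _ ⟩
      ∑< t f + ∑< n f                          ∎)

  eval : ∀ {n} → Vector Carrier n → Carrier → Carrier
  eval {zero}  a x = 0#
  eval {suc n} a x = head a + x * eval (tail a) x

  eval-sum : ∀ {n} (a : Vector Carrier n) x → sum (λ i → x ^ toℕ i * a i) ≈ eval a x
  eval-sum {zero}  a x = refl
  eval-sum {suc n} a x = +-cong (*-identityˡ _) (begin
    sum (λ i → x ^ suc (toℕ i) * tail a i)    ≈⟨ sum-cong-≋ {n} (λ i → *-assoc x _ _) ⟩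
    sum (λ i → x * (x ^ toℕ i * tail a i))    ≈⟨ *-distribˡ-sum {n} x _ ⟨
    x * sum (λ i → x ^ toℕ i * tail a i)      ≈⟨ *-congˡ (eval-sum (tail a) x) ⟩
    x * eval (tail a) x                       ∎)

  -- Synthetic division by X - r, lowest coefficient first: each coefficient of the quotient is the
  -- value at `r` of the part of `a` strictly above that degree.
  quotient : ∀ {n} → Vector Carrier (suc n) → Carrier → Vector Carrier n
  quotient {suc n} a r zero    = eval (tail a) r
  quotient {suc n} a r (suc i) = quotient (tail a) r i

  eval-quotient : ∀ {n} (a : Vector Carrier (suc n)) r x →
                  eval a x ≈ eval a r + eval (quotient a r) x * (x - r)
  eval-quotient {zero} a r x = begin
    head a + x * 0#                     ≈⟨ +-congˡ (trans (zeroʳ x) (sym (zeroʳ r))) ⟩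
    head a + r * 0#                     ≈⟨ +-identityʳ _ ⟨
    head a + r * 0# + 0#                ≈⟨ +-congˡ (zeroˡ _) ⟨
    head a + r * 0# + 0# * (x - r)      ∎
  eval-quotient {suc n} a r x = begin
    a₀ + x * eval b x                                ≈⟨ +-congˡ (*-congˡ (eval-quotient b r x)) ⟩
    a₀ + x * (e + q * (x - r))                       ≈⟨ +-congˡ (distribˡ x e _) ⟩
    a₀ + (x * e + x * (q * (x - r)))                 ≈⟨ +-congˡ (+-cong split (sym (*-assoc x q _))) ⟩
    a₀ + ((r * e + e * (x - r)) + x * q * (x - r))   ≈⟨ +-congˡ (+-assoc _ _ _) ⟩
    a₀ + (r * e + (e * (x - r) + x * q * (x - r)))   ≈⟨ +-assoc _ _ _ ⟨
    a₀ + r * e + (e * (x - r) + x * q * (x - r))     ≈⟨ +-congˡ (distribʳ (x - r) e (x * q)) ⟨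
    a₀ + r * e + (e + x * q) * (x - r)               ∎
    where
    a₀ = head a
    b  = tail a
    e  = eval b r
    q  = eval (quotient b r) x
    split : x * e ≈ r * e + e * (x - r)
    split = begin
      x * e                      ≈⟨ xyx⁻¹≈y (r * e) (x * e) ⟨
      r * e + x * e - r * e      ≈⟨ +-assoc _ _ _ ⟩
      r * e + (x * e - r * e)    ≈⟨ +-congˡ (*-distribʳ-- e x r) ⟨
      r * e + (x - r) * e        ≈⟨ +-congˡ (*-comm _ e) ⟩
      r * e + e * (x - r)        ∎

  -- The constant coefficient of the quotient is the value of `tail a` at `r`. If it vanishes, the
  -- root condition leaves only `head a`; it is also the root condition for `tail a`, so the
  -- argument recurs on the coefficients.
  quotient-zero : ∀ {n} (a : Vector Carrier (suc n)) r → eval a r ≈ 0# →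
                  (∀ i → quotient a r i ≈ 0#) → ∀ i → a i ≈ 0#
  quotient-zero {n} a r root q≈0 = λ { zero → head≈0 ; (suc i) → tail≈0 n a q≈0 i }
    where
    eval-tail : ∀ n (a : Vector Carrier (suc n)) → (∀ i → quotient a r i ≈ 0#) → eval (tail a) r ≈ 0#
    eval-tail zero    a q≈0 = refl
    eval-tail (suc n) a q≈0 = q≈0 zero
    head≈0 : head a ≈ 0#
    head≈0 = begin
      head a                         ≈⟨ +-identityʳ _ ⟨
      head a + 0#                    ≈⟨ +-congˡ (trans (*-congˡ (eval-tail n a q≈0)) (zeroʳ r)) ⟨
      head a + r * eval (tail a) r   ≈⟨ root ⟩
      0#                             ∎
    tail≈0 : ∀ n (a : Vector Carrier (suc n)) → (∀ i → quotient a r i ≈ 0#) → ∀ i → tail a i ≈ 0#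
    tail≈0 (suc n) a q≈0 = quotient-zero (tail a) r (q≈0 zero) (q≈0 ∘ suc)

  -- Stated as cancellation because the disjunction `x ≈ 0#` or `y ≈ 0#` would ask for a decision
  -- that equality of Cauchy reals does not provide.
  NoZeroDivisors : Set _
  NoZeroDivisors = ∀ {x y} → x * y ≈ 0# → ¬ (y ≈ 0#) → x ≈ 0#

  -- Induction on the number of roots: after division by X - `ζ zero` the other roots remain roots
  -- of the quotient, since `ζ (suc i) - ζ zero` can be cancelled.
  distinct-roots⇒zero : NoZeroDivisors → ∀ {n} (ζ : Vector Carrier n) → Injective _≡_ _≈_ ζ →
                        ∀ (a : Vector Carrier n) → (∀ i → eval a (ζ i) ≈ 0#) → ∀ i → a i ≈ 0#
  distinct-roots⇒zero cancel {zero}  ζ distinct a roots ()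
  distinct-roots⇒zero cancel {suc n} ζ distinct a roots =
    quotient-zero a r (roots zero)
      (distinct-roots⇒zero cancel (tail ζ) (Fin.suc-injective ∘ distinct) (quotient a r) λ i →
        cancel (begin
          eval (quotient a r) (ζ (suc i)) * (ζ (suc i) - r)              ≈⟨ +-identityˡ _ ⟨
          0# + eval (quotient a r) (ζ (suc i)) * (ζ (suc i) - r)         ≈⟨ +-congʳ (roots zero) ⟨
          eval a r + eval (quotient a r) (ζ (suc i)) * (ζ (suc i) - r)   ≈⟨ eval-quotient a r (ζ (suc i)) ⟨
          eval a (ζ (suc i))                                             ≈⟨ roots (suc i) ⟩
          0#                                                             ∎)
        λ eq → case (distinct (x-y≈0⇒x≈y eq)) of λ ())
    where r = ζ zero

  Mat : ℕ → Set _
  Mat n = Vector (Vector Carrier n) n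

  infixl 7 _·_
  infix 4 _≋_

  -- Over ℂ, this product, `I` and `vander` compute to `_*ᴹ_`, `1ᴹ` and `vandermonde`, so the ring
  -- results apply there without translation.
  _·_ : ∀ {n} → Mat n → Mat n → Mat n
  _·_ {n} A B i j = sum {n} λ k → A i k * B k j

  I : ∀ {n} → Mat n
  I i j = if does (i Fin.≟ j) then 1# else 0#

  _≋_ : ∀ {n} → Mat n → Mat n → Set _
  A ≋ B = ∀ i j → A i j ≈ B i j

  ·-assoc : ∀ {n} (A B C : Mat n) → (A · B) · C ≋ A · (B · C)
  ·-assoc {n} A B C i j = begin
    sum {n} (λ k → sum {n} (λ l → A i l * B l k) * C k j)
      ≈⟨ sum-cong-≋ {n} (λ k → *-distribʳ-sum {n} (C k j) _) ⟩
    sum {n} (λ k → sum {n} (λ l → A i l * B l k * C k j))      ≈⟨ ∑-comm {n} {n} _ ⟩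
    sum {n} (λ l → sum {n} (λ k → A i l * B l k * C k j))
      ≈⟨ sum-cong-≋ {n} (λ l → sum-cong-≋ {n} λ k → *-assoc _ _ _) ⟩
    sum {n} (λ l → sum {n} (λ k → A i l * (B l k * C k j)))
      ≈⟨ sum-cong-≋ {n} (λ l → sym (*-distribˡ-sum {n} (A i l) _)) ⟩
    sum {n} (λ l → A i l * sum {n} (λ k → B l k * C k j))      ∎

  ·-congˡ : ∀ {n} (A : Mat n) {B C} → B ≋ C → A · B ≋ A · C
  ·-congˡ {n} A B≋C i j = sum-cong-≋ {n} λ k → *-congˡ (B≋C k j)

  ·-congʳ : ∀ {n} (A : Mat n) {B C} → B ≋ C → B · A ≋ C · A
  ·-congʳ {n} A B≋C i j = sum-cong-≋ {n} λ k → *-congʳ (B≋C i k)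

  δ-sumˡ : ∀ {n} (i : Fin n) (f : Fin n → Carrier) → sum (λ k → I i k * f k) ≈ f i
  δ-sumˡ {suc n} zero f = begin
    1# * f zero + sum (λ k → 0# * f (suc k))   ≈⟨ +-cong (*-identityˡ _) (sum-cong-≋ {n} λ k → zeroˡ _) ⟩
    f zero + sum {n} (λ k → 0#)                ≈⟨ +-congˡ (sum-replicate-zero n) ⟩
    f zero + 0#                                ≈⟨ +-identityʳ _ ⟩
    f zero                                     ∎
  δ-sumˡ {suc n} (suc i) f = begin
    0# * f zero + sum (λ k → I i k * f (suc k))   ≈⟨ +-cong (zeroˡ _) (δ-sumˡ i (f ∘ suc)) ⟩
    0# + f (suc i)                                ≈⟨ +-identityˡ _ ⟩
    f (suc i)                                     ∎

  I-sym : ∀ {n} (i j : Fin n) → I i j ≡ I j i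
  I-sym zero    zero    = ≡.refl
  I-sym zero    (suc j) = ≡.refl
  I-sym (suc i) zero    = ≡.refl
  I-sym (suc i) (suc j) = I-sym i j

  ·-identityˡ : ∀ {n} (A : Mat n) → I · A ≋ A
  ·-identityˡ A i j = δ-sumˡ i λ k → A k j

  ·-identityʳ : ∀ {n} (A : Mat n) → A · I ≋ A
  ·-identityʳ {n} A i j = trans
    (sum-cong-≋ {n} λ k → trans (*-comm _ _) (*-congʳ (reflexive (I-sym k j))))
    (δ-sumˡ j (A i))

  -- Carries the estimate for the explicit inverse over to the arbitrary `V⁻¹` of the theorem.
  inverse-unique : ∀ {n} (A B C : Mat n) → B · A ≋ I → A · C ≋ I → B ≋ C
  inverse-unique A B C BA≋I AC≋I i j = begin
    B i j               ≈⟨ ·-identityʳ B i j ⟨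
    (B · I) i j         ≈⟨ ·-congˡ B AC≋I i j ⟨
    (B · (A · C)) i j   ≈⟨ ·-assoc B A C i j ⟨
    ((B · A) · C) i j   ≈⟨ ·-congʳ C BA≋I i j ⟩
    (I · C) i j         ≈⟨ ·-identityˡ C i j ⟩
    C i j               ∎

  vander : ∀ {n} → Vector Carrier n → Mat n
  vander ζ i j = ζ i ^ toℕ j

  -- The columns of W · V - I are coefficient vectors of polynomials of degree < n with n roots.
  vander-inverse : NoZeroDivisors → ∀ {n} (ζ : Vector Carrier n) → Injective _≡_ _≈_ ζ →
                   ∀ W → vander ζ · W ≋ I → W · vander ζ ≋ I
  vander-inverse cancel {n} ζ distinct W VW≋I i j = x-y≈0⇒x≈y
    (distinct-roots⇒zero cancel ζ distinct (λ k → (W · V) k j - I k j) (λ k → begin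
      eval (λ l → (W · V) l j - I l j) (ζ k)
        ≈⟨ eval-sum (λ l → (W · V) l j - I l j) (ζ k) ⟨
      sum {n} (λ l → V k l * ((W · V) l j - I l j))
        ≈⟨ sum-cong-≋ {n} (λ l → distribˡ _ _ _) ⟩
      sum {n} (λ l → V k l * (W · V) l j + V k l * - I l j)          ≈⟨ ∑-distrib-+ {n} _ _ ⟩
      (V · (W · V)) k j + sum {n} (λ l → V k l * - I l j)            ≈⟨ +-cong (V-W-V k) (negate k) ⟩
      V k j - V k j                                                  ≈⟨ -‿inverseʳ _ ⟩
      0#                                                             ∎) i)
    where
    V = vander ζ
    V-W-V : ∀ k → (V · (W · V)) k j ≈ V k j
    V-W-V k = begin
      (V · (W · V)) k j   ≈⟨ ·-assoc V W V k j ⟨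
      ((V · W) · V) k j   ≈⟨ ·-congʳ V VW≋I k j ⟩
      (I · V) k j         ≈⟨ ·-identityˡ V k j ⟩
      V k j               ∎
    negate : ∀ k → sum {n} (λ l → V k l * - I l j) ≈ - V k j
    negate k = begin
      sum {n} (λ l → V k l * - I l j)
        ≈⟨ sum-cong-≋ {n} (λ l → trans (sym (-‿distribʳ-* _ _)) (trans (-‿distribˡ-* _ _) (*-congʳ (sym (-1*x≈-x _))))) ⟩
      sum {n} (λ l → - 1# * V k l * I l j)     ≈⟨ ·-identityʳ (λ k l → - 1# * V k l) k j ⟩
      - 1# * V k j                             ≈⟨ -1*x≈-x _ ⟩
      - V k j                                  ∎

  -- The explicit inverse of the Vandermonde matrix

  module _ (cancel : NoZeroDivisors) where

    -- The powers of `u` have period `n`, and a shift by one multiplies them by `u`.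
    geometric-zero : ∀ n u → u ^ n ≈ 1# → ¬ (u ≈ 1#) → ∑< n (u ^_) ≈ 0#
    geometric-zero n u u^n≈1 u≉1 = cancel
      (periodic-sum n 1 u (u ^_)
        (λ j → trans (^-homo-* u n j) (trans (*-congʳ u^n≈1) (*-identityˡ _)))
        (λ j → refl))
      (u≉1 ∘ x-y≈0⇒x≈y)

    ones-sum : ∀ n u → u ≈ 1# → ∑< n (u ^_) ≈ ∑< n (λ _ → 1#)
    ones-sum n u u≈1 = ∑<-cong n λ j _ → trans (^-congˡ j u≈1) (1^n≈1 j)

    module _ (k t : ℕ) .{{_ : ℕ.NonZero t}} where
      private
        m = k ℕ.* t
        n = m ℕ.+ t

      -- Here `k` stands for p - 1, and `c` for 1/n with n written as a sum of ones, which avoids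
      -- mapping ℕ into the ring. Together `ζ^n≈1` and `ζ^t≉1` make each `ζ i` a root of the sum of
      -- X^(tb) over b ≤ k.
      module CyclotomicPrimePower
        (c : Carrier) (c*n≈1 : c * ∑< n (λ _ → 1#) ≈ 1#)
        (ζ ζ⁻¹ : Vector Carrier m) (distinct : Injective _≡_ _≈_ ζ)
        (ζ^n≈1 : ∀ i → ζ i ^ n ≈ 1#) (ζ^t≉1 : ∀ i → ¬ (ζ i ^ t ≈ 1#))
        (ζ⁻¹*ζ≈1 : ∀ i → ζ⁻¹ i * ζ i ≈ 1#)
        where

        W : Mat m
        W j i = c * (ζ⁻¹ i ^ toℕ j - ζ⁻¹ i ^ (toℕ j ℕ.% t ℕ.+ m))

        ζ⁻¹^n≈1 : ∀ i → ζ⁻¹ i ^ n ≈ 1#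
        ζ⁻¹^n≈1 i = begin
          ζ⁻¹ i ^ n                ≈⟨ *-identityʳ _ ⟨
          ζ⁻¹ i ^ n * 1#           ≈⟨ *-congˡ (ζ^n≈1 i) ⟨
          ζ⁻¹ i ^ n * ζ i ^ n      ≈⟨ ^-distrib-* _ _ n ⟨
          (ζ⁻¹ i * ζ i) ^ n        ≈⟨ ^-congˡ n (ζ⁻¹*ζ≈1 i) ⟩
          1# ^ n                   ≈⟨ 1^n≈1 n ⟩
          1#                       ∎

        j+m%t≡j : ∀ j → j ℕ.< t → (m ℕ.+ j) ℕ.% t ≡ j
        j+m%t≡j j j<t = ≡.trans (≡.cong (ℕ._% t) (ℕ.+-comm m j))
          (≡.trans (ℕ.[m+kn]%n≡m%n j k t) (ℕ.m<n⇒m%n≡m j<t))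

        module _ (i l : Fin m) where
          private
            x = ζ i
            y = ζ⁻¹ l
            g h f : ℕ → Carrier
            g j = x ^ j * y ^ j
            h j = x ^ j * y ^ (j ℕ.% t ℕ.+ m)
            f j = x ^ j * (y ^ j - y ^ (j ℕ.% t ℕ.+ m))

          -- The second factor of `h` depends only on `j` modulo `t`, so a shift by `t` multiplies
          -- `h` by `x ^ t`, while a shift by `n`, a multiple of `t`, changes nothing. Cancelling
          -- `x ^ t - 1#` replaces the explicit splitting into residue classes.
          h-sum : ∑< n h ≈ 0#
          h-sum = cancel
            (periodic-sum n t (x ^ t) h
              (λ j → *-cong
                (trans (^-homo-* x n j) (trans (*-congʳ (ζ^n≈1 i)) (*-identityˡ _)))
                (reflexive (≡.cong (λ r → y ^ (r ℕ.+ m)) (n+j%t j))))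
              (λ j → trans
                (*-cong (^-homo-* x t j) (reflexive (≡.cong (λ r → y ^ (r ℕ.+ m)) (t+j%t j))))
                (*-assoc _ _ _)))
            (ζ^t≉1 i ∘ x-y≈0⇒x≈y)
            where
            t+j%t : ∀ j → (t ℕ.+ j) ℕ.% t ≡ j ℕ.% t
            t+j%t j = ≡.trans (≡.cong (ℕ._% t) (ℕ.+-comm t j)) (ℕ.[m+n]%n≡m%n j t)
            n+j%t : ∀ j → (n ℕ.+ j) ℕ.% t ≡ j ℕ.% t
            n+j%t j = ≡.trans (≡.cong (ℕ._% t) (≡.trans (ℕ.+-comm n j) (≡.cong (j ℕ.+_) (ℕ.+-comm m t))))
              (ℕ.[m+kn]%n≡m%n j (suc k) t)

          f-sum : ∑< m f ≈ ∑< n ((x * y) ^_)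
          f-sum = begin
            -- The terms for m ≤ j < n are zero, so the short sum may be completed to a full period,
            -- where the two halves of `f` can be summed separately.
            ∑< m f                                       ≈⟨ +-identityʳ _ ⟨
            ∑< m f + 0#                                  ≈⟨ +-congˡ (∑<-zero t tail-zero) ⟨
            ∑< m f + ∑< t (λ j → f (m ℕ.+ j))            ≈⟨ ∑<-+ m t f ⟨
            ∑< n f
              ≈⟨ ∑<-cong n {f} {λ j → g j - h j} (λ j _ → *-distribˡ-- (x ^ j) (y ^ j) _) ⟩
            ∑< n (λ j → g j - h j)                       ≈⟨ ∑-distrib-+ {n} _ _ ⟩
            ∑< n g + ∑< n (λ j → - h j)
              ≈⟨ +-cong (∑<-cong n λ j _ → sym (^-distrib-* x y j)) neg-h-sum ⟩
            ∑< n ((x * y) ^_) + 0#                       ≈⟨ +-identityʳ _ ⟩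
            ∑< n ((x * y) ^_)                            ∎
            where
            tail-zero : ∀ j → j ℕ.< t → f (m ℕ.+ j) ≈ 0#
            tail-zero j j<t = trans (*-congˡ (x≈y⇒x-y≈0 (reflexive (≡.cong (y ^_)
              (≡.trans (ℕ.+-comm m j) (≡.cong (ℕ._+ m) (≡.sym (j+m%t≡j j j<t)))))))) (zeroʳ _)
            neg-h-sum : ∑< n (λ j → - h j) ≈ 0#
            neg-h-sum = begin
              ∑< n (λ j → - h j)           ≈⟨ ∑<-cong n (λ j _ → sym (-1*x≈-x (h j))) ⟩
              ∑< n (λ j → - 1# * h j)      ≈⟨ *-distribˡ-sum {n} (- 1#) _ ⟨
              - 1# * ∑< n h                ≈⟨ *-congˡ h-sum ⟩
              - 1# * 0#                    ≈⟨ zeroʳ _ ⟩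
              0#                           ∎

          entry : (vander ζ · W) i l ≈ c * ∑< n ((x * y) ^_)
          entry = begin
            ∑< m (λ j → x ^ j * (c * (y ^ j - y ^ (j ℕ.% t ℕ.+ m))))
              ≈⟨ ∑<-cong m (λ j _ → swap (x ^ j) c (y ^ j - y ^ (j ℕ.% t ℕ.+ m))) ⟩
            ∑< m (λ j → c * f j)                                       ≈⟨ *-distribˡ-sum {m} c _ ⟨
            c * ∑< m f                                                 ≈⟨ *-congˡ f-sum ⟩
            c * ∑< n ((x * y) ^_)                                      ∎
            where
            swap : ∀ a b d → a * (b * d) ≈ b * (a * d)
            swap a b d = trans (sym (*-assoc a b d)) (trans (*-congʳ (*-comm a b)) (*-assoc b a d))

          product-root : (x * y) ^ n ≈ 1#
          product-root = begin
            (x * y) ^ n       ≈⟨ ^-distrib-* x y n ⟩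
            x ^ n * y ^ n     ≈⟨ *-cong (ζ^n≈1 i) (ζ⁻¹^n≈1 l) ⟩
            1# * 1#           ≈⟨ *-identityˡ _ ⟩
            1#                ∎

          product≈1⇒≡ : x * y ≈ 1# → i ≡ l
          product≈1⇒≡ xy≈1 = distinct (begin
            x                ≈⟨ *-identityʳ x ⟨
            x * 1#           ≈⟨ *-congˡ (ζ⁻¹*ζ≈1 l) ⟨
            x * (y * ζ l)    ≈⟨ *-assoc x y _ ⟨
            x * y * ζ l      ≈⟨ *-congʳ xy≈1 ⟩
            1# * ζ l         ≈⟨ *-identityˡ _ ⟩
            ζ l              ∎)

        V·W≋I : vander ζ · W ≋ I
        -- The case distinction is on indices, whose equality is decidable; `distinct` turns it into
        -- one on the roots.
        V·W≋I i l with i Fin.≟ l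
        ... | yes ≡.refl = trans (entry i i) (trans
                (*-congˡ (ones-sum n _ (trans (*-comm _ _) (ζ⁻¹*ζ≈1 i)))) c*n≈1)
        ... | no i≢l = trans (entry i l) (trans
                (*-congˡ (geometric-zero n _ (product-root i l) (i≢l ∘ product≈1⇒≡ i l))) (zeroʳ c))

        W·V≋I : W · vander ζ ≋ I
        W·V≋I = vander-inverse cancel ζ distinct W V·W≋I

-- The totient of a prime power

module _ {P : Pred ℕ 0ℓ} (P? : Decidable P) where

  -- The argument `f` carries the offset: cutting a range in two leaves a shifted index function on
  -- the second piece.
  count : (ℕ → ℕ) → ℕ → ℕ
  count f n = length (filter P? (applyUpTo f n))

  count-+ : ∀ f a b → count f (a ℕ.+ b) ≡ count f a ℕ.+ count (λ j → f (a ℕ.+ j)) b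
  count-+ f zero    b = ≡.refl
  count-+ f (suc a) b with P? (f 0)
  ... | yes _ = ≡.cong suc (count-+ (f ∘ suc) a b)
  ... | no  _ = count-+ (f ∘ suc) a b

  count-cong : ∀ {f g} → (∀ j → P (f j) → P (g j)) → (∀ j → P (g j) → P (f j)) →
               ∀ n → count f n ≡ count g n
  count-cong         f⇒g g⇒f zero    = ≡.refl
  count-cong {f} {g} f⇒g g⇒f (suc n) with P? (f 0) | P? (g 0)
  ... | yes _ | yes _ = ≡.cong suc (count-cong (f⇒g ∘ suc) (g⇒f ∘ suc) n)
  ... | no _  | no _  = count-cong (f⇒g ∘ suc) (g⇒f ∘ suc) n
  ... | yes p | no ¬p = contradiction (f⇒g 0 p) ¬p
  ... | no ¬p | yes p = contradiction (g⇒f 0 p) ¬p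

  count-all : ∀ f n → (∀ j → j ℕ.< n → P (f j)) → count f n ≡ n
  count-all f zero    all = ≡.refl
  count-all f (suc n) all with P? (f 0)
  ... | yes _ = ≡.cong suc (count-all (f ∘ suc) n λ j j<n → all (suc j) (ℕ.s<s j<n))
  ... | no ¬p = contradiction (all 0 ℕ.z<s) ¬p

  count-none : ∀ f → ¬ P (f 0) → count f 1 ≡ 0
  count-none f ¬p with P? (f 0)
  ... | yes p = contradiction p ¬p
  ... | no _  = ≡.refl

prime∤⇒coprime : ∀ {p a} → Prime p → ¬ (p ∣ a) → Coprime p a
prime∤⇒coprime p-prime p∤a (d∣p , d∣a) with prime⇒irreducible p-prime d∣p
... | inj₁ d≡1    = d≡1
... | inj₂ ≡.refl = contradiction d∣a p∤a

-- A common divisor d of `a * b` and `c` is coprime to `a`, because it divides `c`. Hence d divides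
-- `b`, and then it is 1.
coprime-* : ∀ {a b c} → Coprime a c → Coprime b c → Coprime (a ℕ.* b) c
coprime-* a⊥c b⊥c (d∣ab , d∣c) = b⊥c
  (Coprime.coprime-divisor (λ (e∣d , e∣a) → a⊥c (e∣a , ℕ.∣-trans e∣d d∣c)) d∣ab , d∣c)

coprime-^ : ∀ {a c} → Coprime a c → ∀ l → Coprime (a ℕ.^ l) c
coprime-^ {c = c} a⊥c zero    = Coprime.1-coprimeTo c
coprime-^         a⊥c (suc l) = coprime-* a⊥c (coprime-^ a⊥c l)

module _ {p} (p-prime : Prime p) where
  private
    instance
      _ = prime⇒nonZero p-prime
      _ = prime⇒nonTrivial p-prime
    Q? = λ a → ¬? (p ∣? a)

  -- By blocks of length `p`: among 1, ..., p only the last is a multiple of `p`, and adding `p`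
  -- preserves divisibility by `p`.
  count-nonmultiples : ∀ q → count Q? suc (q ℕ.* p) ≡ q ℕ.* (p ℕ.∸ 1)
  count-nonmultiples zero    = ≡.refl
  count-nonmultiples (suc q) = begin
    count Q? suc (p ℕ.+ q ℕ.* p)                                   ≡⟨ count-+ Q? suc p (q ℕ.* p) ⟩
    count Q? suc p ℕ.+ count Q? (λ j → suc (p ℕ.+ j)) (q ℕ.* p)    ≡⟨ ≡.cong₂ ℕ._+_ block shift ⟩
    (p ℕ.∸ 1) ℕ.+ count Q? suc (q ℕ.* p)
      ≡⟨ ≡.cong ((p ℕ.∸ 1) ℕ.+_) (count-nonmultiples q) ⟩
    (p ℕ.∸ 1) ℕ.+ q ℕ.* (p ℕ.∸ 1)                                  ∎
    where
    open ≡.≡-Reasoning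
    p-1+1≡p : (p ℕ.∸ 1) ℕ.+ 1 ≡ p
    p-1+1≡p = ℕ.m∸n+n≡m (ℕ.>-nonZero⁻¹ p)
    block : count Q? suc p ≡ p ℕ.∸ 1
    block = begin
      count Q? suc p                                                  ≡⟨ ≡.cong (count Q? suc) p-1+1≡p ⟨
      count Q? suc ((p ℕ.∸ 1) ℕ.+ 1)                                  ≡⟨ count-+ Q? suc (p ℕ.∸ 1) 1 ⟩
      count Q? suc (p ℕ.∸ 1) ℕ.+ count Q? (λ j → suc ((p ℕ.∸ 1) ℕ.+ j)) 1
        ≡⟨ ≡.cong₂ ℕ._+_
             (count-all Q? suc (p ℕ.∸ 1) λ j j<p-1 → ℕ.>⇒∤ (ℕ.<-≤-trans (ℕ.s<s j<p-1)
               (ℕ.≤-reflexive (≡.trans (ℕ.+-comm 1 _) p-1+1≡p))))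
             (count-none Q? (λ j → suc ((p ℕ.∸ 1) ℕ.+ j)) λ p∤ → p∤ (ℕ.∣-reflexive
               (≡.trans (≡.sym p-1+1≡p) (ℕ.+-suc (p ℕ.∸ 1) 0)))) ⟩
      (p ℕ.∸ 1) ℕ.+ 0                                                 ≡⟨ ℕ.+-identityʳ _ ⟩
      p ℕ.∸ 1                                                         ∎
    shift : count Q? (λ j → suc (p ℕ.+ j)) (q ℕ.* p) ≡ count Q? suc (q ℕ.* p)
    shift = count-cong Q?
      (λ j p∤ p∣ → p∤ (≡.subst (p ∣_) (ℕ.+-suc p j) (ℕ.∣m∣n⇒∣m+n ℕ.∣-refl p∣)))
      (λ j p∤ p∣ → p∤ (ℕ.∣m+n∣m⇒∣n (≡.subst (p ∣_) (≡.sym (ℕ.+-suc p j)) p∣) ℕ.∣-refl))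
      (q ℕ.* p)

  -- Coprimality to a positive power of `p` is the same as not being divisible by `p`, so the filter
  -- in `φ` selects the nonmultiples.
  φ-prime-power : ∀ l → φ (p ℕ.^ suc l) ≡ (p ℕ.∸ 1) ℕ.* p ℕ.^ l
  φ-prime-power l = begin
    length (filter (coprime? n) (map suc (upTo n)))
      ≡⟨ ≡.cong length (List.filter-≐ (coprime? n) Q? (⊥⇒∤ , ∤⇒⊥) (map suc (upTo n))) ⟩
    length (filter Q? (map suc (upTo n)))             ≡⟨ ≡.cong (length ∘ filter Q?) (List.map-upTo suc n) ⟩
    count Q? suc (p ℕ.* p ℕ.^ l)                      ≡⟨ ≡.cong (count Q? suc) (ℕ.*-comm p (p ℕ.^ l)) ⟩
    count Q? suc (p ℕ.^ l ℕ.* p)                      ≡⟨ count-nonmultiples (p ℕ.^ l) ⟩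
    p ℕ.^ l ℕ.* (p ℕ.∸ 1)                             ≡⟨ ℕ.*-comm (p ℕ.^ l) _ ⟩
    (p ℕ.∸ 1) ℕ.* p ℕ.^ l                             ∎
    where
    open ≡.≡-Reasoning
    n = p ℕ.^ suc l
    ∤⇒⊥ : ∀ {a} → ¬ (p ∣ a) → Coprime n a
    ∤⇒⊥ p∤a = coprime-^ (prime∤⇒coprime p-prime p∤a) (suc l)
    ⊥⇒∤ : ∀ {a} → Coprime n a → ¬ (p ∣ a)
    ⊥⇒∤ n⊥a p∣a = ℕ.nonTrivial⇒≢1 (n⊥a (ℕ.m∣m*n (p ℕ.^ l) , p∣a))

-- The ring of Cauchy reals

∣p∣*∣p∣≡p*p : ∀ p → ℚ.∣ p ∣ ℚ.* ℚ.∣ p ∣ ≡ p ℚ.* p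
∣p∣*∣p∣≡p*p p with ℚ.∣p∣≡p∨∣p∣≡-p p
... | inj₁ eq = ≡.cong₂ ℚ._*_ eq eq
... | inj₂ eq = ≡.trans (≡.cong₂ ℚ._*_ eq eq)
                  (solve 1 (λ p → (:- p) :* (:- p) := p :* p) ≡.refl p)

*-nonneg : ∀ {p q} → 0ℚ ℚ.≤ p → 0ℚ ℚ.≤ q → 0ℚ ℚ.≤ p ℚ.* q
*-nonneg 0≤p 0≤q = *-mono-≤ {p = 0ℚ} {r = 0ℚ} ℚ.≤-refl 0≤p 0≤p 0≤q

0≤p*p : ∀ p → 0ℚ ℚ.≤ p ℚ.* p
0≤p*p p = ≡.subst (0ℚ ℚ.≤_) (∣p∣*∣p∣≡p*p p) (*-nonneg (ℚ.0≤∣p∣ p) (ℚ.0≤∣p∣ p))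

p*p≤ε*ε⇒∣p∣≤ε : ∀ {p ε} → 0ℚ ℚ.< ε → p ℚ.* p ℚ.≤ ε ℚ.* ε → ℚ.∣ p ∣ ℚ.≤ ε
p*p≤ε*ε⇒∣p∣≤ε {p} {ε} 0<ε pp≤εε with ℚ.∣ p ∣ ℚ.≤? ε
... | yes ∣p∣≤ε = ∣p∣≤ε
... | no  ∣p∣≰ε = contradiction (begin-strict
  ε ℚ.* ε              ≤⟨ ℚ.*-monoˡ-≤-nonNeg ε {{ℚ.nonNegative (ℚ.<⇒≤ 0<ε)}} (ℚ.<⇒≤ ε<∣p∣) ⟩
  ε ℚ.* ℚ.∣ p ∣        <⟨ ℚ.*-monoˡ-<-pos ℚ.∣ p ∣ {{ℚ.positive (ℚ.<-trans 0<ε ε<∣p∣)}} ε<∣p∣ ⟩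
  ℚ.∣ p ∣ ℚ.* ℚ.∣ p ∣  ≡⟨ ∣p∣*∣p∣≡p*p p ⟩
  p ℚ.* p              ≤⟨ pp≤εε ⟩
  ε ℚ.* ε              ∎) (ℚ.<-irrefl ≡.refl)
  where
  open ℚ.≤-Reasoning
  ε<∣p∣ = ℚ.≰⇒> ∣p∣≰ε

∣p-p∣≤ : ∀ p {ε} → 0ℚ ℚ.< ε → ℚ.∣ p ℚ.- p ∣ ℚ.≤ ε
∣p-p∣≤ p 0<ε = ℚ.≤-trans (ℚ.≤-reflexive (≡.cong ℚ.∣_∣ (ℚ.+-inverseʳ p))) (ℚ.<⇒≤ 0<ε)

∣p-q∣≡∣q-p∣ : ∀ p q → ℚ.∣ p ℚ.- q ∣ ≡ ℚ.∣ q ℚ.- p ∣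
∣p-q∣≡∣q-p∣ p q = ≡.trans (≡.sym (ℚ.∣-p∣≡∣p∣ (p ℚ.- q)))
  (≡.cong ℚ.∣_∣ (solve 2 (λ p q → :- (p :- q) := q :- p) ≡.refl p q))

∣p∣≤∣q∣+∣p-q∣ : ∀ p q → ℚ.∣ p ∣ ℚ.≤ ℚ.∣ q ∣ ℚ.+ ℚ.∣ p ℚ.- q ∣
∣p∣≤∣q∣+∣p-q∣ p q = ≡.subst (λ r → ℚ.∣ r ∣ ℚ.≤ ℚ.∣ q ∣ ℚ.+ ℚ.∣ p ℚ.- q ∣)
  (solve 2 (λ p q → q :+ (p :- q) := p) ≡.refl p q) (ℚ.∣p+q∣≤∣p∣+∣q∣ q (p ℚ.- q))

∣p+q∣≤ε : ∀ {ε} p q → ℚ.∣ p ∣ ℚ.≤ ½ ℚ.* ε → ℚ.∣ q ∣ ℚ.≤ ½ ℚ.* ε → ℚ.∣ p ℚ.+ q ∣ ℚ.≤ ε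
∣p+q∣≤ε {ε} p q ∣p∣≤ ∣q∣≤ = ℚ.≤-trans (ℚ.∣p+q∣≤∣p∣+∣q∣ p q)
  (ℚ.≤-trans (ℚ.+-mono-≤ ∣p∣≤ ∣q∣≤) (ℚ.≤-reflexive (½+½ ε)))

0≤½* : ∀ {ε} → 0ℚ ℚ.< ε → 0ℚ ℚ.≤ ½ ℚ.* ε
0≤½* = ℚ.<⇒≤ ∘ 0<½*

-- Ring operations act on each rational approximation separately, so polynomial identities hold
-- index by index and reduce to ℚ without any ε.
termwise : ∀ {x y} → (∀ n → seq x n ≡ seq y n) → x ≃ᴿ y
termwise {x} {y} x≡y = mk≃ λ ε 0<ε → 0 , λ n _ →
  ≡.subst (λ q → ℚ.∣ seq x n ℚ.- q ∣ ℚ.≤ ε) (x≡y n) (∣p-p∣≤ (seq x n) 0<ε)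

≃ᴿ-sym : ∀ {x y} → x ≃ᴿ y → y ≃ᴿ x
≃ᴿ-sym {x} {y} x≃y = mk≃ λ ε 0<ε → let (N , h) = close x≃y ε 0<ε in N , λ n N≤n →
  ≡.subst (ℚ._≤ ε) (∣p-q∣≡∣q-p∣ (seq x n) (seq y n)) (h n N≤n)

≃ᴿ-trans : ∀ {x y z} → x ≃ᴿ y → y ≃ᴿ z → x ≃ᴿ z
≃ᴿ-trans {x} {y} {z} x≃y y≃z = mk≃ λ ε 0<ε →
  let (M , hM) = close x≃y (½ ℚ.* ε) (0<½* 0<ε)
      (N , hN) = close y≃z (½ ℚ.* ε) (0<½* 0<ε)
  in M ℕ.⊔ N , λ n ≤n → ≡.subst (λ q → ℚ.∣ q ∣ ℚ.≤ ε)
    (solve 3 (λ a b c → (a :- b) :+ (b :- c) := a :- c) ≡.refl (seq x n) (seq y n) (seq z n))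
    (∣p+q∣≤ε (seq x n ℚ.- seq y n) (seq y n ℚ.- seq z n)
      (hM n (ℕ.m⊔n≤o⇒m≤o M N ≤n)) (hN n (ℕ.m⊔n≤o⇒n≤o M N ≤n)))

+ᴿ-cong : ∀ {x y u v} → x ≃ᴿ y → u ≃ᴿ v → x +ᴿ u ≃ᴿ y +ᴿ v
+ᴿ-cong {x} {y} {u} {v} x≃y u≃v = mk≃ λ ε 0<ε →
  let (M , hM) = close x≃y (½ ℚ.* ε) (0<½* 0<ε)
      (N , hN) = close u≃v (½ ℚ.* ε) (0<½* 0<ε)
  in M ℕ.⊔ N , λ n ≤n → ≡.subst (λ q → ℚ.∣ q ∣ ℚ.≤ ε)
    (solve 4 (λ a b c d → (a :- b) :+ (c :- d) := (a :+ c) :- (b :+ d)) ≡.refl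
      (seq x n) (seq y n) (seq u n) (seq v n))
    (∣p+q∣≤ε (seq x n ℚ.- seq y n) (seq u n ℚ.- seq v n)
      (hM n (ℕ.m⊔n≤o⇒m≤o M N ≤n)) (hN n (ℕ.m⊔n≤o⇒n≤o M N ≤n)))

-ᴿ-cong : ∀ {x y} → x ≃ᴿ y → -ᴿ x ≃ᴿ -ᴿ y
-ᴿ-cong {x} {y} x≃y = mk≃ λ ε 0<ε → let (N , h) = close x≃y ε 0<ε in N , λ n N≤n →
  ≡.subst (ℚ._≤ ε)
    (≡.trans (∣p-q∣≡∣q-p∣ (seq x n) (seq y n))
      (≡.cong ℚ.∣_∣ (solve 2 (λ a b → b :- a := (:- a) :- (:- b)) ≡.refl (seq x n) (seq y n))))
    (h n N≤n)

*ᴿ-cong : ∀ {x y u v} → x ≃ᴿ y → u ≃ᴿ v → x *ᴿ u ≃ᴿ y *ᴿ v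
*ᴿ-cong {x} {y} {u} {v} x≃y u≃v = mk≃ λ ε 0<ε →
  let (B , 0<B , M₁ , hB) = eventuallyBounded (cauchy x)
      (C , 0<C , M₂ , hC) = eventuallyBounded (cauchy v)
      (η , 0<η , Kη≡ε)    = divide (ℚ.+-mono-< 0<B 0<C) 0<ε
      (N₁ , hxy) = close x≃y η 0<η
      (N₂ , huv) = close u≃v η 0<η
      M = M₁ ℕ.⊔ M₂
      N = N₁ ℕ.⊔ N₂
  in M ℕ.⊔ N , λ n ≤n →
    let M≤n = ℕ.m⊔n≤o⇒m≤o M N ≤n
        N≤n = ℕ.m⊔n≤o⇒n≤o M N ≤n
    in ≡.subst (ℚ.∣ seq x n ℚ.* seq u n ℚ.- seq y n ℚ.* seq v n ∣ ℚ.≤_) Kη≡ε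
      (*-step {seq x n} {seq y n} {seq u n} {seq v n} 0<B 0<C
        (hB n (ℕ.m⊔n≤o⇒m≤o M₁ M₂ M≤n)) (hC n (ℕ.m⊔n≤o⇒n≤o M₁ M₂ M≤n))
        (hxy n (ℕ.m⊔n≤o⇒m≤o N₁ N₂ N≤n)) (huv n (ℕ.m⊔n≤o⇒n≤o N₁ N₂ N≤n)))

≃ᴿ-refl : ∀ {x} → x ≃ᴿ x
≃ᴿ-refl = termwise λ _ → ≡.refl

ℝ-commutativeRing : CommutativeRing 0ℓ 0ℓ
ℝ-commutativeRing = record
  { Carrier = ℝ
  ; _≈_ = _≃ᴿ_
  ; _+_ = _+ᴿ_
  ; _*_ = _*ᴿ_
  ; -_  = -ᴿ_
  ; 0#  = fromℚ 0ℚ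
  ; 1#  = fromℚ 1ℚ
  ; isCommutativeRing = record
    { isRing = record
      { +-isAbelianGroup = record
        { isGroup = record
          { isMonoid = record
            { isSemigroup = record
              { isMagma = record
                { isEquivalence = record { refl = ≃ᴿ-refl ; sym = ≃ᴿ-sym ; trans = ≃ᴿ-trans }
                ; ∙-cong = +ᴿ-cong
                }
              ; assoc = λ x y z → termwise λ n → ℚ.+-assoc (seq x n) (seq y n) (seq z n)
              }
            ; identity = (λ x → termwise λ n → ℚ.+-identityˡ (seq x n))
                       , (λ x → termwise λ n → ℚ.+-identityʳ (seq x n))
            }
          ; inverse = (λ x → termwise λ n → ℚ.+-inverseˡ (seq x n))
                    , (λ x → termwise λ n → ℚ.+-inverseʳ (seq x n))
          ; ⁻¹-cong = -ᴿ-cong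
          }
        ; comm = λ x y → termwise λ n → ℚ.+-comm (seq x n) (seq y n)
        }
      ; *-cong = *ᴿ-cong
      ; *-assoc = λ x y z → termwise λ n → ℚ.*-assoc (seq x n) (seq y n) (seq z n)
      ; *-identity = (λ x → termwise λ n → ℚ.*-identityˡ (seq x n))
                   , (λ x → termwise λ n → ℚ.*-identityʳ (seq x n))
      ; distrib = (λ x y z → termwise λ n → ℚ.*-distribˡ-+ (seq x n) (seq y n) (seq z n))
                , (λ x y z → termwise λ n → ℚ.*-distribʳ-+ (seq x n) (seq y n) (seq z n))
      }
    ; *-comm = λ x y → termwise λ n → ℚ.*-comm (seq x n) (seq y n)
    }
  }

module ℝ-Ring = CommutativeRing ℝ-commutativeRing
module ℝ-Exp = Exp ℝ-Ring.commutativeSemiring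
module ℝ-Sums = RingSums ℝ-commutativeRing

null : ∀ {x} → (∀ ε → 0ℚ ℚ.< ε → ∃ λ N → ∀ n → N ℕ.≤ n → ℚ.∣ seq x n ∣ ℚ.≤ ε) → x ≃ᴿ fromℚ 0ℚ
null {x} h = mk≃ λ ε 0<ε → let (N , hN) = h ε 0<ε in N , λ n N≤n →
  ≡.subst (λ q → ℚ.∣ q ∣ ℚ.≤ ε) (≡.sym (ℚ.+-identityʳ (seq x n))) (hN n N≤n)

null⁻¹ : ∀ {x} → x ≃ᴿ fromℚ 0ℚ → ∀ ε → 0ℚ ℚ.< ε → ∃ λ N → ∀ n → N ℕ.≤ n → ℚ.∣ seq x n ∣ ℚ.≤ ε
null⁻¹ {x} x≃0 ε 0<ε = let (N , h) = close x≃0 ε 0<ε in N , λ n N≤n →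
  ≡.subst (λ q → ℚ.∣ q ∣ ℚ.≤ ε) (ℚ.+-identityʳ (seq x n)) (h n N≤n)

-- The lower bound `δ` of |x| is cancelled in ℚ, which takes the place of multiplying by a
-- reciprocal of `x`.
*-null-apart : ∀ {x y} δ → 0ℚ ℚ.< δ → ∀ N → (∀ n → N ℕ.≤ n → δ ℚ.≤ ℚ.∣ seq x n ∣) →
               x *ᴿ y ≃ᴿ fromℚ 0ℚ → y ≃ᴿ fromℚ 0ℚ
*-null-apart {x} {y} δ 0<δ N δ≤ xy≃0 = null λ η 0<η →
  let (M , h) = null⁻¹ xy≃0 (δ ℚ.* η) (*-pos 0<δ 0<η) in M ℕ.⊔ N , λ n ≤n →
    ℚ.*-cancelˡ-≤-pos δ {{ℚ.positive 0<δ}} (begin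
      δ ℚ.* ℚ.∣ seq y n ∣                 ≤⟨ ℚ.*-monoʳ-≤-nonNeg ℚ.∣ seq y n ∣ {{ℚ.nonNegative (ℚ.0≤∣p∣ (seq y n))}}
                                               (δ≤ n (ℕ.m⊔n≤o⇒n≤o M N ≤n)) ⟩
      ℚ.∣ seq x n ∣ ℚ.* ℚ.∣ seq y n ∣     ≡⟨ ℚ.∣p*q∣≡∣p∣*∣q∣ (seq x n) (seq y n) ⟨
      ℚ.∣ seq x n ℚ.* seq y n ∣           ≤⟨ h n (ℕ.m⊔n≤o⇒m≤o M N ≤n) ⟩
      δ ℚ.* η                             ∎)
  where open ℚ.≤-Reasoning

-- For each ε the comparison of one rational approximation of x with ε/2 decides between |x| ≤ ε
-- and |x| bounded away from 0; the latter would force y ≃ 0.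
ℝ-noZeroDivisors : ℝ-Sums.NoZeroDivisors
ℝ-noZeroDivisors {x} {y} xy≃0 y≄0 = null small
  where
  small : ∀ ε → 0ℚ ℚ.< ε → ∃ λ N → ∀ n → N ℕ.≤ n → ℚ.∣ seq x n ∣ ℚ.≤ ε
  -- From index `N` on, `x` varies by at most ε/4. So |x_N| ≤ ε/2 gives |x_n| ≤ 3ε/4, and otherwise
  -- |x_n| ≥ ε/4.
  small ε 0<ε with cauchy x (½ ℚ.* (½ ℚ.* ε)) (0<½* (0<½* 0<ε))
  ... | N , h with ℚ.∣ seq x N ∣ ℚ.≤? ½ ℚ.* ε
  ...   | yes ∣xN∣≤ = N , λ n N≤n → begin
    ℚ.∣ seq x n ∣                                      ≤⟨ ∣p∣≤∣q∣+∣p-q∣ (seq x n) (seq x N) ⟩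
    ℚ.∣ seq x N ∣ ℚ.+ ℚ.∣ seq x n ℚ.- seq x N ∣        ≤⟨ ℚ.+-mono-≤ ∣xN∣≤ (h n N N≤n ℕ.≤-refl) ⟩
    e ℚ.+ ½ ℚ.* e                                      ≤⟨ ℚ.+-monoʳ-≤ e (ℚ.≤-trans (ℚ.≤-reflexive (≡.sym (ℚ.+-identityʳ (½ ℚ.* e))))
                                                            (ℚ.+-monoʳ-≤ (½ ℚ.* e) (0≤½* (0<½* 0<ε)))) ⟩
    e ℚ.+ (½ ℚ.* e ℚ.+ ½ ℚ.* e)                        ≡⟨ ≡.cong (e ℚ.+_) (½+½ e) ⟩
    e ℚ.+ e                                            ≡⟨ ½+½ ε ⟩
    ε                                                  ∎
    where
    open ℚ.≤-Reasoning
    e = ½ ℚ.* ε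
  ...   | no ∣xN∣≰ = contradiction (*-null-apart {x} {y} q (0<½* (0<½* 0<ε)) N q≤ xy≃0) y≄0
    where
    open ℚ.≤-Reasoning
    e = ½ ℚ.* ε
    q = ½ ℚ.* e
    q≤ : ∀ n → N ℕ.≤ n → q ℚ.≤ ℚ.∣ seq x n ∣
    q≤ n N≤n = begin
      q
        ≡⟨ solve 1 (λ q → q := (q :+ q) :- q) ≡.refl q ⟩
      (q ℚ.+ q) ℚ.- q                                                ≡⟨ ≡.cong (ℚ._- q) (½+½ e) ⟩
      e ℚ.- q
        ≤⟨ ℚ.+-monoˡ-≤ (ℚ.- q) (ℚ.<⇒≤ (ℚ.≰⇒> ∣xN∣≰)) ⟩
      ℚ.∣ seq x N ∣ ℚ.- q
        ≤⟨ ℚ.+-monoˡ-≤ (ℚ.- q) (∣p∣≤∣q∣+∣p-q∣ (seq x N) (seq x n)) ⟩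
      ℚ.∣ seq x n ∣ ℚ.+ ℚ.∣ seq x N ℚ.- seq x n ∣ ℚ.- q
        ≤⟨ ℚ.+-monoˡ-≤ (ℚ.- q) (ℚ.+-monoʳ-≤ ℚ.∣ seq x n ∣ (h N n ℕ.≤-refl N≤n)) ⟩
      ℚ.∣ seq x n ∣ ℚ.+ q ℚ.- q
        ≡⟨ solve 2 (λ a q → a :+ q :- q := a) ≡.refl ℚ.∣ seq x n ∣ q ⟩
      ℚ.∣ seq x n ∣                                                  ∎

x*x+y*y≃0⇒x≃0 : ∀ {x y} → x *ᴿ x +ᴿ y *ᴿ y ≃ᴿ fromℚ 0ℚ → x ≃ᴿ fromℚ 0ℚ
x*x+y*y≃0⇒x≃0 {x} {y} h = null λ ε 0<ε →
  let (N , hN) = null⁻¹ h (ε ℚ.* ε) (*-pos 0<ε 0<ε) in N , λ n N≤n →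
    p*p≤ε*ε⇒∣p∣≤ε 0<ε (let a = seq x n ; b = seq y n in begin
      a ℚ.* a                          ≡⟨ ℚ.+-identityʳ _ ⟨
      a ℚ.* a ℚ.+ 0ℚ                   ≤⟨ ℚ.+-monoʳ-≤ (a ℚ.* a) (0≤p*p b) ⟩
      a ℚ.* a ℚ.+ b ℚ.* b              ≤⟨ p≤∣p∣ _ ⟩
      ℚ.∣ a ℚ.* a ℚ.+ b ℚ.* b ∣        ≤⟨ hN n N≤n ⟩
      ε ℚ.* ε                          ∎)
  where open ℚ.≤-Reasoning

-- Complex numbers

ℂ-commutativeRing : CommutativeRing 0ℓ 0ℓ
ℂ-commutativeRing = record
  { Carrier = ℂ
  ; _≈_ = _≃ᶜ_
  ; _+_ = _+_
  ; _*_ = _·_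
  ; -_  = -_
  ; 0#  = 0#
  ; 1#  = 1#
  ; isCommutativeRing = record
    { isRing = record
      { +-isAbelianGroup = record
        { isGroup = record
          { isMonoid = record
            { isSemigroup = record
              { isMagma = record
                { isEquivalence = record
                  { refl  = mk≃ᶜ R.refl R.refl
                  ; sym   = λ p → mk≃ᶜ (R.sym (re-≃ p)) (R.sym (im-≃ p))
                  ; trans = λ p q → mk≃ᶜ (R.trans (re-≃ p) (re-≃ q)) (R.trans (im-≃ p) (im-≃ q))
                  }
                ; ∙-cong = λ p q → mk≃ᶜ (R.+-cong (re-≃ p) (re-≃ q)) (R.+-cong (im-≃ p) (im-≃ q))
                }
              ; assoc = λ x y z → mk≃ᶜ (R.+-assoc _ _ _) (R.+-assoc _ _ _)
              }
            ; identity = (λ x → mk≃ᶜ (R.+-identityˡ _) (R.+-identityˡ _))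
                       , (λ x → mk≃ᶜ (R.+-identityʳ _) (R.+-identityʳ _))
            }
          ; inverse = (λ x → mk≃ᶜ (R.-‿inverseˡ _) (R.-‿inverseˡ _))
                    , (λ x → mk≃ᶜ (R.-‿inverseʳ _) (R.-‿inverseʳ _))
          ; ⁻¹-cong = λ p → mk≃ᶜ (R.-‿cong (re-≃ p)) (R.-‿cong (im-≃ p))
          }
        ; comm = λ x y → mk≃ᶜ (R.+-comm _ _) (R.+-comm _ _)
        }
      ; *-cong = λ p q → mk≃ᶜ
          (R.+-cong (R.*-cong (re-≃ p) (re-≃ q)) (R.-‿cong (R.*-cong (im-≃ p) (im-≃ q))))
          (R.+-cong (R.*-cong (re-≃ p) (im-≃ q)) (R.*-cong (im-≃ p) (re-≃ q)))
      ; *-assoc = λ (a +i b) (c +i d) (e +i f) → mk≃ᶜ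
          (termwise λ n → solve 6 (λ a b c d e f →
              (a :* c :+ :- (b :* d)) :* e :+ :- ((a :* d :+ b :* c) :* f)
              := a :* (c :* e :+ :- (d :* f)) :+ :- (b :* (c :* f :+ d :* e))) ≡.refl
            (seq a n) (seq b n) (seq c n) (seq d n) (seq e n) (seq f n))
          (termwise λ n → solve 6 (λ a b c d e f →
              (a :* c :+ :- (b :* d)) :* f :+ (a :* d :+ b :* c) :* e
              := a :* (c :* f :+ d :* e) :+ b :* (c :* e :+ :- (d :* f))) ≡.refl
            (seq a n) (seq b n) (seq c n) (seq d n) (seq e n) (seq f n))
      ; *-identity =
            (λ (a +i b) → mk≃ᶜ
              (termwise λ n → solve 2 (λ a b → con 1ℚ :* a :+ :- (con 0ℚ :* b) := a) ≡.refl (seq a n) (seq b n))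
              (termwise λ n → solve 2 (λ a b → con 1ℚ :* b :+ con 0ℚ :* a := b) ≡.refl (seq a n) (seq b n)))
          , (λ (a +i b) → mk≃ᶜ
              (termwise λ n → solve 2 (λ a b → a :* con 1ℚ :+ :- (b :* con 0ℚ) := a) ≡.refl (seq a n) (seq b n))
              (termwise λ n → solve 2 (λ a b → a :* con 0ℚ :+ b :* con 1ℚ := b) ≡.refl (seq a n) (seq b n)))
      ; distrib =
            (λ (a +i b) (c +i d) (e +i f) → mk≃ᶜ
              (termwise λ n → solve 6 (λ a b c d e f →
                  a :* (c :+ e) :+ :- (b :* (d :+ f))
                  := (a :* c :+ :- (b :* d)) :+ (a :* e :+ :- (b :* f))) ≡.refl
                (seq a n) (seq b n) (seq c n) (seq d n) (seq e n) (seq f n))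
              (termwise λ n → solve 6 (λ a b c d e f →
                  a :* (d :+ f) :+ b :* (c :+ e)
                  := (a :* d :+ b :* c) :+ (a :* f :+ b :* e)) ≡.refl
                (seq a n) (seq b n) (seq c n) (seq d n) (seq e n) (seq f n)))
          , (λ (a +i b) (c +i d) (e +i f) → mk≃ᶜ
              (termwise λ n → solve 6 (λ a b c d e f →
                  (c :+ e) :* a :+ :- ((d :+ f) :* b)
                  := (c :* a :+ :- (d :* b)) :+ (e :* a :+ :- (f :* b))) ≡.refl
                (seq a n) (seq b n) (seq c n) (seq d n) (seq e n) (seq f n))
              (termwise λ n → solve 6 (λ a b c d e f →
                  (c :+ e) :* b :+ (d :+ f) :* a
                  := (c :* b :+ d :* a) :+ (e :* b :+ f :* a)) ≡.refl
                (seq a n) (seq b n) (seq c n) (seq d n) (seq e n) (seq f n)))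
      }
    ; *-comm = λ (a +i b) (c +i d) → mk≃ᶜ
        (termwise λ n → solve 4 (λ a b c d → a :* c :+ :- (b :* d) := c :* a :+ :- (d :* b)) ≡.refl
          (seq a n) (seq b n) (seq c n) (seq d n))
        (termwise λ n → solve 4 (λ a b c d → a :* d :+ b :* c := c :* b :+ d :* a) ≡.refl
          (seq a n) (seq b n) (seq c n) (seq d n))
    }
  }
  where
  open RawRing ℂ-rawRing using (_+_; -_; 0#; 1#) renaming (_*_ to _·_)
  module R = ℝ-Ring

module ℂ-Ring = CommutativeRing ℂ-commutativeRing
module ℂ-Sums = RingSums ℂ-commutativeRing

-- Polynomial in the coordinates, unlike the square of `∣ z ∣`, whose root is rounded at every
-- index; identities for it are therefore termwise.
normSq : ℂ → ℝ
normSq z = re z *ᴿ re z +ᴿ im z *ᴿ im z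

normSq-cong : ∀ {z w} → z ≃ᶜ w → normSq z ≃ᴿ normSq w
normSq-cong p = ℝ-Ring.+-cong (ℝ-Ring.*-cong (re-≃ p) (re-≃ p)) (ℝ-Ring.*-cong (im-≃ p) (im-≃ p))

normSq-* : ∀ z w → normSq (z ℂ-Ring.* w) ≃ᴿ normSq z *ᴿ normSq w
normSq-* (a +i b) (c +i d) = termwise λ n → solve 4 (λ a b c d →
    (a :* c :+ :- (b :* d)) :* (a :* c :+ :- (b :* d)) :+ (a :* d :+ b :* c) :* (a :* d :+ b :* c)
    := (a :* a :+ b :* b) :* (c :* c :+ d :* d)) ≡.refl
  (seq a n) (seq b n) (seq c n) (seq d n)

normSq≃0⇒≈0 : ∀ {z} → normSq z ≃ᴿ fromℚ 0ℚ → z ≃ᶜ ℂ-Ring.0#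
normSq≃0⇒≈0 {a +i b} h = mk≃ᶜ (x*x+y*y≃0⇒x≃0 {a} {b} h)
  (x*x+y*y≃0⇒x≃0 {b} {a} (ℝ-Ring.trans (ℝ-Ring.+-comm _ _) h))

≈0⇒normSq≃0 : ∀ {z} → z ≃ᶜ ℂ-Ring.0# → normSq z ≃ᴿ fromℚ 0ℚ
≈0⇒normSq≃0 h = ℝ-Ring.trans (normSq-cong h) (termwise λ _ → ≡.refl)

-- Multiplicativity of the squared modulus transfers cancellation from ℝ, and a sum of two squares
-- vanishes only if both do.
ℂ-noZeroDivisors : ℂ-Sums.NoZeroDivisors
ℂ-noZeroDivisors {z} {w} zw≈0 w≉0 = normSq≃0⇒≈0 (ℝ-noZeroDivisors
  (ℝ-Ring.trans (ℝ-Ring.sym (normSq-* z w)) (≈0⇒normSq≃0 zw≈0))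
  (w≉0 ∘ normSq≃0⇒≈0))

conj : ℂ → ℂ
conj (a +i b) = a +i (-ᴿ b)

conj-* : ∀ z → normSq z ≃ᴿ fromℚ 1ℚ → conj z ℂ-Ring.* z ≃ᶜ ℂ-Ring.1#
conj-* (a +i b) h = mk≃ᶜ
  (ℝ-Ring.trans (termwise λ n → solve 2 (λ a b → a :* a :+ :- ((:- b) :* b) := a :* a :+ b :* b)
    ≡.refl (seq a n) (seq b n)) h)
  (termwise λ n → solve 2 (λ a b → a :* b :+ (:- b) :* a := con 0ℚ) ≡.refl (seq a n) (seq b n))

normSq-conj : ∀ z → normSq (conj z) ≃ᴿ normSq z
normSq-conj (a +i b) = termwise λ n →
  solve 2 (λ a b → a :* a :+ (:- b) :* (:- b) := a :* a :+ b :* b) ≡.refl (seq a n) (seq b n)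

normSq-^ : ∀ z n → normSq (z ℂR.^ n) ≃ᴿ normSq z ℝR.^ n
normSq-^ z zero    = termwise λ _ → ≡.refl
normSq-^ z (suc n) = ℝ-Ring.trans (normSq-* z (z ℂR.^ n)) (ℝ-Ring.*-congˡ (normSq-^ z n))

normSq-^≃1 : ∀ z n → normSq z ≃ᴿ fromℚ 1ℚ → normSq (z ℂR.^ n) ≃ᴿ fromℚ 1ℚ
normSq-^≃1 z n h = ℝ-Ring.trans (normSq-^ z n)
  (ℝ-Ring.trans (ℝ-Exp.^-congˡ n h) (ℝ-Sums.1^n≈1 n))

-- Nonnegativity of every approximation, which is stronger than that of the limit. Sums of squares
-- and values of `√_` have it, and it spares an ε in each estimate.
NonNeg : ℝ → Set
NonNeg x = ∀ n → 0ℚ ℚ.≤ seq x n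

NonNeg-sum : ∀ {m} (f : Vector ℝ m) → (∀ i → NonNeg (f i)) → NonNeg (ℝR.sum f)
NonNeg-sum {zero}  f f≥0 n = ℚ.≤-refl
NonNeg-sum {suc m} f f≥0 n = ℚ.+-mono-≤ (f≥0 zero n) (NonNeg-sum (f ∘ suc) (f≥0 ∘ suc) n)

NonNeg-^ : ∀ {x} → NonNeg x → ∀ k → NonNeg (x ℝR.^ k)
NonNeg-^ x≥0 zero    n = ℚ.nonNegative⁻¹ 1ℚ
NonNeg-^ x≥0 (suc k) n = *-nonneg (x≥0 n) (NonNeg-^ x≥0 k n)

NonNeg-normSq : ∀ z → NonNeg (normSq z)
NonNeg-normSq z n = ℚ.+-mono-≤ (0≤p*p (seq (re z) n)) (0≤p*p (seq (im z) n))

1+NonNeg≄0 : ∀ {x} → NonNeg x → ¬ (fromℚ 1ℚ +ᴿ x ≃ᴿ fromℚ 0ℚ)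
1+NonNeg≄0 {x} x≥0 h with null⁻¹ h ½ (ℚ.positive⁻¹ ½)
... | N , hN = contradiction (begin-strict
    ½                          <⟨ ℚ.*<* (ℤ.+<+ (ℕ.s<s (ℕ.s≤s ℕ.z≤n))) ⟩
    1ℚ                         ≡⟨ ℚ.+-identityʳ 1ℚ ⟨
    1ℚ ℚ.+ 0ℚ                  ≤⟨ ℚ.+-monoʳ-≤ 1ℚ (x≥0 N) ⟩
    1ℚ ℚ.+ seq x N             ≤⟨ p≤∣p∣ _ ⟩
    ℚ.∣ 1ℚ ℚ.+ seq x N ∣       ≤⟨ hN N ℕ.≤-refl ⟩
    ½                          ∎) (ℚ.<-irrefl ≡.refl)
  where
  open ℚ.≤-Reasoning

-- r^n - 1 = (1 + r + … + r^(n-1)) (r - 1), and the first factor is at least 1.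
root-of-unity-nonneg : ∀ n .{{_ : ℕ.NonZero n}} {r} → NonNeg r → r ℝR.^ n ≃ᴿ fromℚ 1ℚ → r ≃ᴿ fromℚ 1ℚ
root-of-unity-nonneg n@(suc k) {r} r≥0 r^n≃1 = ℝ-Sums.x-y≈0⇒x≈y
  (ℝ-noZeroDivisors
    -- Cancellation removes the right factor, so the geometric sum is moved there. As `n` is
    -- `suc k`, that sum computes to 1 plus a nonnegative remainder.
    (ℝ-Ring.trans (ℝ-Ring.*-comm (r ℝ-Ring.- ℝ-Ring.1#) (ℝ-Sums.∑< n (r ℝR.^_)))
      (ℝ-Sums.periodic-sum n 1 r (r ℝR.^_)
        (λ j → ℝ-Ring.trans (ℝ-Exp.^-homo-* r n j) (ℝ-Ring.trans (ℝ-Ring.*-congʳ r^n≃1) (ℝ-Ring.*-identityˡ _)))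
        (λ j → ℝ-Ring.refl)))
    (1+NonNeg≄0 (NonNeg-sum {k} (λ i → r ℝR.^ suc (toℕ i)) λ i → NonNeg-^ r≥0 (suc (toℕ i)))))

-- The squared modulus is a nonnegative real whose `n`-th power is 1. This makes the conjugate an
-- inverse and fixes the size of all powers that occur.
normSq-root-of-unity : ∀ n .{{_ : ℕ.NonZero n}} z → z ℂR.^ n ≃ᶜ ℂ-Ring.1# → normSq z ≃ᴿ fromℚ 1ℚ
normSq-root-of-unity n z z^n≈1 = root-of-unity-nonneg n (NonNeg-normSq z)
  (ℝ-Ring.trans (ℝ-Ring.sym (normSq-^ z n))
    (ℝ-Ring.trans (normSq-cong z^n≈1) (termwise λ _ → ≡.refl)))

-- Order of the reals and bounds for the Frobenius norm

termwise-≤ : ∀ {x y} → (∀ n → seq x n ℚ.≤ seq y n) → x ≤ᴿ y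
termwise-≤ {x} {y} x≤y = mk≤ λ ε 0<ε → 0 , λ n _ →
  ℚ.≤-trans (x≤y n) (ℚ.≤-trans (ℚ.≤-reflexive (≡.sym (ℚ.+-identityʳ (seq y n))))
    (ℚ.+-monoʳ-≤ (seq y n) (ℚ.<⇒≤ 0<ε)))

≤ᴿ-reflexive : ∀ {x y} → x ≃ᴿ y → x ≤ᴿ y
≤ᴿ-reflexive {x} {y} x≃y = mk≤ λ ε 0<ε → let (N , h) = close x≃y ε 0<ε in N , λ n N≤n →
  ℚ.≤-trans (p≤q+∣p-q∣ (seq x n) (seq y n)) (ℚ.+-monoʳ-≤ (seq y n) (h n N≤n))

≤ᴿ-trans : ∀ {x y z} → x ≤ᴿ y → y ≤ᴿ z → x ≤ᴿ z
≤ᴿ-trans {x} {y} {z} x≤y y≤z = mk≤ λ ε 0<ε →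
  let (M , hM) = bound x≤y (½ ℚ.* ε) (0<½* 0<ε)
      (N , hN) = bound y≤z (½ ℚ.* ε) (0<½* 0<ε)
  in M ℕ.⊔ N , λ n ≤n → begin
    seq x n                                     ≤⟨ hM n (ℕ.m⊔n≤o⇒m≤o M N ≤n) ⟩
    seq y n ℚ.+ ½ ℚ.* ε                         ≤⟨ ℚ.+-monoˡ-≤ (½ ℚ.* ε) (hN n (ℕ.m⊔n≤o⇒n≤o M N ≤n)) ⟩
    seq z n ℚ.+ ½ ℚ.* ε ℚ.+ ½ ℚ.* ε             ≡⟨ ℚ.+-assoc (seq z n) _ _ ⟩
    seq z n ℚ.+ (½ ℚ.* ε ℚ.+ ½ ℚ.* ε)           ≡⟨ ≡.cong (seq z n ℚ.+_) (½+½ ε) ⟩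
    seq z n ℚ.+ ε                               ∎
  where open ℚ.≤-Reasoning

+ᴿ-mono-≤ : ∀ {x y u v} → x ≤ᴿ y → u ≤ᴿ v → x +ᴿ u ≤ᴿ y +ᴿ v
+ᴿ-mono-≤ {x} {y} {u} {v} x≤y u≤v = mk≤ λ ε 0<ε →
  let (M , hM) = bound x≤y (½ ℚ.* ε) (0<½* 0<ε)
      (N , hN) = bound u≤v (½ ℚ.* ε) (0<½* 0<ε)
  in M ℕ.⊔ N , λ n ≤n → begin
    seq x n ℚ.+ seq u n
      ≤⟨ ℚ.+-mono-≤ (hM n (ℕ.m⊔n≤o⇒m≤o M N ≤n)) (hN n (ℕ.m⊔n≤o⇒n≤o M N ≤n)) ⟩
    (seq y n ℚ.+ ½ ℚ.* ε) ℚ.+ (seq v n ℚ.+ ½ ℚ.* ε)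
      ≡⟨ solve 3 (λ y v e → (y :+ e) :+ (v :+ e) := (y :+ v) :+ (e :+ e)) ≡.refl (seq y n) (seq v n) (½ ℚ.* ε) ⟩
    (seq y n ℚ.+ seq v n) ℚ.+ (½ ℚ.* ε ℚ.+ ½ ℚ.* ε)           ≡⟨ ≡.cong ((seq y n ℚ.+ seq v n) ℚ.+_) (½+½ ε) ⟩
    (seq y n ℚ.+ seq v n) ℚ.+ ε                               ∎
  where open ℚ.≤-Reasoning

-- Multiplication by `z` scales the slack `η` of `x ≤ᴿ y`; as `z` is eventually at most some `B`,
-- the choice η = ε/B keeps it below ε.
*ᴿ-monoʳ-≤ : ∀ {z} → NonNeg z → ∀ {x y} → x ≤ᴿ y → x *ᴿ z ≤ᴿ y *ᴿ z
*ᴿ-monoʳ-≤ {z} z≥0 {x} {y} x≤y = mk≤ λ ε 0<ε →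
  let (B , 0<B , M , hB) = eventuallyBounded (cauchy z)
      (η , 0<η , Bη≡ε)   = divide 0<B 0<ε
      (N , hN)           = bound x≤y η 0<η
  in M ℕ.⊔ N , λ n ≤n →
    let instance
          z≥0ₙ = ℚ.nonNegative (z≥0 n)
          η≥0  = ℚ.nonNegative (ℚ.<⇒≤ 0<η)
    in begin
    seq x n ℚ.* seq z n                      ≤⟨ ℚ.*-monoʳ-≤-nonNeg (seq z n) (hN n (ℕ.m⊔n≤o⇒n≤o M N ≤n)) ⟩
    (seq y n ℚ.+ η) ℚ.* seq z n
      ≡⟨ solve 3 (λ y e z → (y :+ e) :* z := y :* z :+ z :* e) ≡.refl (seq y n) η (seq z n) ⟩
    seq y n ℚ.* seq z n ℚ.+ seq z n ℚ.* η    ≤⟨ ℚ.+-monoʳ-≤ (seq y n ℚ.* seq z n) (ℚ.*-monoʳ-≤-nonNeg η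
                                                  (ℚ.≤-trans (p≤∣p∣ (seq z n)) (hB n (ℕ.m⊔n≤o⇒m≤o M N ≤n)))) ⟩
    seq y n ℚ.* seq z n ℚ.+ B ℚ.* η          ≡⟨ ≡.cong (seq y n ℚ.* seq z n ℚ.+_) Bη≡ε ⟩
    seq y n ℚ.* seq z n ℚ.+ ε                ∎
  where open ℚ.≤-Reasoning

sum-≤ : ∀ {m} (f : Vector ℝ m) q → (∀ i → f i ≤ᴿ fromℚ q) → ℝR.sum f ≤ᴿ fromℚ (fromℕℚ m ℚ.* q)
sum-≤ {zero}  f q f≤q = ≤ᴿ-reflexive (termwise λ n → ≡.sym (ℚ.*-zeroˡ q))
sum-≤ {suc m} f q f≤q = ≤ᴿ-trans (+ᴿ-mono-≤ (f≤q zero) (sum-≤ (f ∘ suc) q (f≤q ∘ suc)))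
  (≤ᴿ-reflexive (termwise λ n → ≡.trans
    (solve 2 (λ m q → q :+ m :* q := (m :+ con 1ℚ) :* q) ≡.refl (fromℕℚ m) q)
    (≡.cong (ℚ._* q) (≡.sym (fromℕ-suc m)))))

√-≤ : ∀ {x s} → 0ℚ ℚ.≤ s → x ≤ᴿ fromℚ (s ℚ.* s) → √ x ≤ᴿ fromℚ s
√-≤ {x} {s} 0≤s x≤ss = mk≤ λ ε 0<ε →
  let e = ½ ℚ.* ε
      0<e = 0<½* 0<ε
      (N , hN) = bound x≤ss (e ℚ.* e) (*-pos 0<e 0<e)
  in N , λ n N≤n → ≡.subst (λ q → sqrtℚ n (seq x n) ℚ.≤ s ℚ.+ q) (½+½ ε)
    -- The constant `s` serves as the root of `s * s`; it is exact, so its rounding error `d` is 0.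
    -- Slack e² under the root becomes 2e = ε outside.
    (sqrt-step {d = 0ℚ} 0≤s ℚ.≤-refl 0<e (ℚ.<⇒≤ 0<e) (sqrtℚ-lower n (seq x n))
      (ℚ.≤-reflexive (≡.cong₂ ℚ._*_ (≡.sym (ℚ.+-identityʳ s)) (≡.sym (ℚ.+-identityʳ s))))
      (ℚ.⊔-lub (hN n N≤n) (ℚ.+-mono-≤ (*-nonneg 0≤s 0≤s) (ℚ.<⇒≤ (*-pos 0<e 0<e)))))

-- `sqrtℚ` rounds down, so this direction holds at every index, and it is the one that an upper
-- bound on norms asks for.
∣z∣^2≤normSq : ∀ z → ∣ z ∣ ℝR.^ 2 ≤ᴿ normSq z
∣z∣^2≤normSq z = termwise-≤ λ n → let a = seq (re z) n ; b = seq (im z) n ; s = seq ∣ z ∣ n in begin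
  s ℚ.* (s ℚ.* 1ℚ)                                            ≡⟨ ≡.cong (s ℚ.*_) (ℚ.*-identityʳ s) ⟩
  s ℚ.* s
    ≤⟨ sqrtℚ-lower n (a ℚ.* (a ℚ.* 1ℚ) ℚ.+ b ℚ.* (b ℚ.* 1ℚ)) ⟩
  (a ℚ.* (a ℚ.* 1ℚ) ℚ.+ b ℚ.* (b ℚ.* 1ℚ)) ℚ.⊔ 0ℚ
    ≡⟨ ≡.cong₂ (λ u v → (a ℚ.* u ℚ.+ b ℚ.* v) ℚ.⊔ 0ℚ) (ℚ.*-identityʳ a) (ℚ.*-identityʳ b) ⟩
  (a ℚ.* a ℚ.+ b ℚ.* b) ℚ.⊔ 0ℚ                                ≡⟨ ℚ.p≥q⇒p⊔q≡p (NonNeg-normSq z n) ⟩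
  a ℚ.* a ℚ.+ b ℚ.* b                                         ∎
  where open ℚ.≤-Reasoning

‖‖-≤ : ∀ {m k} (A : Matrix m k) q s → 0ℚ ℚ.≤ s → fromℕℚ m ℚ.* (fromℕℚ k ℚ.* q) ℚ.≤ s ℚ.* s →
       (∀ i j → normSq (A i j) ≤ᴿ fromℚ q) → ‖ A ‖ ≤ᴿ fromℚ s
‖‖-≤ {m} {k} A q s 0≤s mkq≤ss A≤q = √-≤ 0≤s (≤ᴿ-trans
  (sum-≤ (λ i → ℝR.sum λ j → ∣ A i j ∣ ℝR.^ 2) (fromℕℚ k ℚ.* q) λ i →
    sum-≤ (λ j → ∣ A i j ∣ ℝR.^ 2) q λ j → ≤ᴿ-trans (∣z∣^2≤normSq (A i j)) (A≤q i j))
  (termwise-≤ λ _ → mkq≤ss))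

NonNeg-‖‖ : ∀ {m k} (A : Matrix m k) → NonNeg ‖ A ‖
NonNeg-‖‖ A n = 0≤sqrtℚ n (seq (ℝR.sum λ i → ℝR.sum λ j → ∣ A i j ∣ ℝR.^ 2) n)

-- |q (z - w)|² = q² (2 |z|² + 2 |w|² - |z + w|²)
normSq-scaled-difference : ∀ q {z w} → normSq z ≃ᴿ fromℚ 1ℚ → normSq w ≃ᴿ fromℚ 1ℚ →
  normSq ((fromℚ q +i fromℚ 0ℚ) ℂ-Ring.* (z ℂ-Ring.- w)) ≤ᴿ
  fromℚ (q ℚ.* q ℚ.* (1ℚ ℚ.+ 1ℚ ℚ.+ (1ℚ ℚ.+ 1ℚ)))
normSq-scaled-difference q {z} {w} ∣z∣²≃1 ∣w∣²≃1 = ≤ᴿ-trans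
  {y = fromℚ (q ℚ.* q) *ᴿ (normSq z +ᴿ normSq w +ᴿ (normSq z +ᴿ normSq w))}
  (termwise-≤ λ n → begin
    L n                                          ≡⟨ ℚ.+-identityʳ (L n) ⟨
    L n ℚ.+ 0ℚ                                   ≤⟨ ℚ.+-monoʳ-≤ (L n) (*-nonneg (0≤p*p q) (NonNeg-normSq (z ℂ-Ring.+ w) n)) ⟩
    L n ℚ.+ q ℚ.* q ℚ.* seq (normSq (z ℂ-Ring.+ w)) n
      ≡⟨ solve 5 (λ a b c d q →
           let re-zw = q :* (a :+ :- c) :+ :- (con 0ℚ :* (b :+ :- d))
               im-zw = q :* (b :+ :- d) :+ con 0ℚ :* (a :+ :- c)
               ∣z∣²   = a :* a :+ b :* b
               ∣w∣²   = c :* c :+ d :* d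
           in re-zw :* re-zw :+ im-zw :* im-zw :+ q :* q :* ((a :+ c) :* (a :+ c) :+ (b :+ d) :* (b :+ d))
              := q :* q :* (∣z∣² :+ ∣w∣² :+ (∣z∣² :+ ∣w∣²)))
           ≡.refl (seq (re z) n) (seq (im z) n) (seq (re w) n) (seq (im w) n) q ⟩
    q ℚ.* q ℚ.* seq (normSq z +ᴿ normSq w +ᴿ (normSq z +ᴿ normSq w)) n ∎)
  (≤ᴿ-reflexive (ℝ-Ring.trans
    (ℝ-Ring.*-congˡ (ℝ-Ring.+-cong (ℝ-Ring.+-cong ∣z∣²≃1 ∣w∣²≃1) (ℝ-Ring.+-cong ∣z∣²≃1 ∣w∣²≃1)))
    (termwise λ _ → ≡.refl)))
  where
  open ℚ.≤-Reasoning
  L : ℕ → ℚ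
  L = seq (normSq ((fromℚ q +i fromℚ 0ℚ) ℂ-Ring.* (z ℂ-Ring.- w)))

∑<-ones : ∀ n → ℂ-Sums.∑< n (λ _ → ℂ-Ring.1#) ≃ᶜ fromℕ n +i fromℚ 0ℚ
∑<-ones zero    = mk≃ᶜ (termwise λ _ → ≡.refl) (termwise λ _ → ≡.refl)
∑<-ones (suc n) = ℂ-Ring.trans (ℂ-Ring.+-congˡ (∑<-ones n)) (mk≃ᶜ
  (termwise λ _ → ≡.trans (ℚ.+-comm 1ℚ (fromℕℚ n)) (≡.sym (fromℕ-suc n)))
  (termwise λ _ → ≡.refl))

-- `recip` is shifted by one, so `recip (ℕ.pred n)` is 1/n.
recip-∑<-ones : ∀ n .{{_ : ℕ.NonZero n}} →
  (fromℚ (recip (ℕ.pred n)) +i fromℚ 0ℚ) ℂ-Ring.* ℂ-Sums.∑< n (λ _ → ℂ-Ring.1#) ≃ᶜ ℂ-Ring.1#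
recip-∑<-ones (suc n) = ℂ-Ring.trans (ℂ-Ring.*-congˡ (∑<-ones (suc n))) (mk≃ᶜ
  (termwise λ _ → ≡.trans
    (solve 2 (λ c s → c :* s :+ :- (con 0ℚ :* con 0ℚ) := s :* c) ≡.refl (recip n) (fromℕℚ (suc n)))
    (recip-inverse n))
  (termwise λ _ → solve 2 (λ c s → c :* con 0ℚ :+ con 0ℚ :* s := con 0ℚ) ≡.refl (recip n) (fromℕℚ (suc n))))

fromℕℚ-mono : ∀ {a b} → a ℕ.≤ b → fromℕℚ a ℚ.≤ fromℕℚ b
fromℕℚ-mono a≤b = /1-mono-≤ (ℤ.+≤+ a≤b)

-- Norm bounds for the Vandermonde matrix and its inverse

module _ (k t : ℕ) .{{_ : ℕ.NonZero t}} where
  private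
    m = k ℕ.* t
    n = m ℕ.+ t
    instance
      n≢0 : ℕ.NonZero n
      n≢0 = ℕ.>-nonZero (ℕ.<-≤-trans (ℕ.>-nonZero⁻¹ t) (ℕ.m≤n+m t m))
    q = recip (ℕ.pred n)

  mq≤1 : fromℕℚ m ℚ.* q ℚ.≤ 1ℚ
  mq≤1 = ℚ.≤-trans
    (ℚ.*-monoʳ-≤-nonNeg q {{ℚ.nonNegative (0≤recip (ℕ.pred n))}} (fromℕℚ-mono (ℕ.m≤m+n m t)))
    (ℚ.≤-reflexive (≡.trans (≡.cong (λ s → fromℕℚ s ℚ.* q) (≡.sym (ℕ.suc-pred n))) (recip-inverse (ℕ.pred n))))

  module _ (k>0 : 0 ℕ.< k) (ζ : Vector ℂ m) (distinct : Injective _≡_ _≃ᶜ_ ζ)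
           (ζ-primitive : ∀ i → IsPrimitiveRoot n (ζ i)) where

    ∣ζ∣²≃1 : ∀ i → normSq (ζ i) ≃ᴿ fromℚ 1ℚ
    ∣ζ∣²≃1 i = normSq-root-of-unity n (ζ i) (proj₁ (ζ-primitive i))

    private
      module W = ℂ-Sums.CyclotomicPrimePower ℂ-noZeroDivisors k t (fromℚ q +i fromℚ 0ℚ)
        (recip-∑<-ones n) ζ (conj ∘ ζ) distinct (proj₁ ∘ ζ-primitive)
        -- Primitivity is applied at the exponent `t`, which lies strictly between 0 and `n = m + t`
        -- because `k > 0` makes `m` positive.
        (λ i → proj₂ (ζ-primitive i) t (ℕ.>-nonZero⁻¹ t) (ℕ.m<n+m t (ℕ.*-mono-< k>0 (ℕ.>-nonZero⁻¹ t))))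
        (λ i → conj-* (ζ i) (∣ζ∣²≃1 i))

    vandermonde-invertible : Invertible (vandermonde ζ)
    vandermonde-invertible = record { inverse = W.W ; inverseˡ = W.W·V≋I ; inverseʳ = W.V·W≋I }

    ‖V‖≤m : ‖ vandermonde ζ ‖ ≤ᴿ fromℕ m
    ‖V‖≤m = ‖‖-≤ (vandermonde ζ) 1ℚ (fromℕℚ m) (0≤fromℕℚ m)
      (ℚ.≤-reflexive (≡.cong (fromℕℚ m ℚ.*_) (ℚ.*-identityʳ (fromℕℚ m))))
      λ i j → ≤ᴿ-reflexive (normSq-^≃1 (ζ i) (toℕ j) (∣ζ∣²≃1 i))

    ‖V⁻¹‖≤2 : (V⁻¹ : Invertible (vandermonde ζ)) → ‖ inverse V⁻¹ ‖ ≤ᴿ fromℚ (1ℚ ℚ.+ 1ℚ)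
    ‖V⁻¹‖≤2 V⁻¹ = ‖‖-≤ (inverse V⁻¹) (q ℚ.* q ℚ.* 4ℚ) 2ℚ (ℚ.nonNegative⁻¹ 2ℚ)
      (begin
        fromℕℚ m ℚ.* (fromℕℚ m ℚ.* (q ℚ.* q ℚ.* 4ℚ))
          ≡⟨ solve 2 (λ m q → m :* (m :* (q :* q :* con 4ℚ)) := (m :* q) :* (m :* q) :* con 4ℚ) ≡.refl (fromℕℚ m) q ⟩
        (fromℕℚ m ℚ.* q) ℚ.* (fromℕℚ m ℚ.* q) ℚ.* 4ℚ
          ≤⟨ ℚ.*-monoʳ-≤-nonNeg 4ℚ (*-mono-≤ 0≤mq (ℚ.nonNegative⁻¹ 1ℚ) mq≤1 mq≤1) ⟩
        2ℚ ℚ.* 2ℚ                                              ∎)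
      λ i j → ≤ᴿ-trans
        (≤ᴿ-reflexive (normSq-cong (ℂ-Sums.inverse-unique (vandermonde ζ) (inverse V⁻¹) W.W
          (inverseˡ V⁻¹) W.V·W≋I i j)))
        (normSq-scaled-difference q (∣ζ⁻¹∣^≃1 j (toℕ i)) (∣ζ⁻¹∣^≃1 j (toℕ i ℕ.% t ℕ.+ m)))
      where
      open ℚ.≤-Reasoning
      2ℚ = 1ℚ ℚ.+ 1ℚ
      4ℚ = 2ℚ ℚ.+ 2ℚ
      0≤mq : 0ℚ ℚ.≤ fromℕℚ m ℚ.* q
      0≤mq = *-nonneg (0≤fromℕℚ m) (0≤recip (ℕ.pred n))
      ∣ζ⁻¹∣^≃1 : ∀ i e → normSq (conj (ζ i) ℂR.^ e) ≃ᴿ fromℚ 1ℚ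
      ∣ζ⁻¹∣^≃1 i e = normSq-^≃1 (conj (ζ i)) e (ℝ-Ring.trans (normSq-conj (ζ i)) (∣ζ∣²≃1 i))

    Cond-vandermonde-≤ : (V⁻¹ : Invertible (vandermonde ζ)) → Cond (vandermonde ζ) V⁻¹ ≤ᴿ fromℕ (m ℕ.* 2)
    Cond-vandermonde-≤ V⁻¹ = ≤ᴿ-trans
      -- One factor is replaced at a time: first ‖V‖ by m, then, after commuting, ‖V⁻¹‖ by 2.
      (*ᴿ-monoʳ-≤ {‖ inverse V⁻¹ ‖} (NonNeg-‖‖ (inverse V⁻¹)) ‖V‖≤m)
      (≤ᴿ-trans (≤ᴿ-reflexive (ℝ-Ring.*-comm (fromℕ m) ‖ inverse V⁻¹ ‖))
      (≤ᴿ-trans (*ᴿ-monoʳ-≤ {fromℕ m} (λ _ → 0≤fromℕℚ m) (‖V⁻¹‖≤2 V⁻¹))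
      (≤ᴿ-reflexive (termwise λ _ → ≡.trans (ℚ.*-comm _ (fromℕℚ m)) (≡.sym (fromℕ-* m 2))))))

open import Data.Nat.Base using (_<_; _∸_; _*_; _^_)

theorem4p1 : (p l : ℕ) → Prime p → ¬ (2 ∣ p) → 1 < l →
    let n = p ^ l
        m = φ n
    in (ζ : Vector ℂ m) → EnumeratesPrimitiveRoots n ζ →
       Invertible (vandermonde ζ) ×
       ((V⁻¹ : Invertible (vandermonde ζ)) →
         Cond (vandermonde ζ) V⁻¹ ≤ᴿ fromℕ (4 * (p ∸ 1) * m))
-- After this match `l` is the exponent minus one, so `t = p ^ l` below is the t of the overview.
theorem4p1 p (suc l) p-prime _ _ = bound-for (φ-prime-power p-prime l) n≡
  where
  instance
    _ = prime⇒nonZero p-prime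
    _ = prime⇒nonTrivial p-prime
    t≢0 = ℕ.m^n≢0 p l
  k = p ∸ 1
  t = p ^ l
  k>0 : 0 < k
  k>0 = ℕ.m<n⇒0<n∸m (ℕ.nonTrivial⇒n>1 p)
  n≡ : p ^ suc l ≡ k * t ℕ.+ t
  n≡ = ≡.trans (≡.cong (_* t) (≡.sym (ℕ.suc-pred p))) (ℕ.+-comm t (ℕ.pred p * t))
  -- The type of `ζ` mentions `φ (p ^ suc l)`; with `m` and `n` as variables both equations can be
  -- matched with `refl` and no vector is transported.
  bound-for : ∀ {m n} → m ≡ k * t → n ≡ k * t ℕ.+ t → (ζ : Vector ℂ m) → EnumeratesPrimitiveRoots n ζ →
    Invertible (vandermonde ζ) ×
    ((V⁻¹ : Invertible (vandermonde ζ)) → Cond (vandermonde ζ) V⁻¹ ≤ᴿ fromℕ (4 * k * m))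
  bound-for ≡.refl ≡.refl ζ enum =
      vandermonde-invertible k t k>0 ζ distinct isPrimitive
    , λ V⁻¹ → ≤ᴿ-trans (Cond-vandermonde-≤ k t k>0 ζ distinct isPrimitive V⁻¹)
        (termwise-≤ λ _ → fromℕℚ-mono (begin
          k * t * 2          ≡⟨ ℕ.*-comm (k * t) 2 ⟩
          -- Here 2 is read as `2 * 1`, with `2 ≤ 4` and `1 ≤ k`, the latter being p - 1 ≥ 1.
          2 * (k * t)        ≤⟨ ℕ.*-monoˡ-≤ (k * t) (ℕ.*-mono-≤ {2} {4} (ℕ.s≤s (ℕ.s≤s ℕ.z≤n)) k>0) ⟩
          4 * k * (k * t)    ∎))
    where
    open EnumeratesPrimitiveRoots enum
    open ℕ.≤-Reasoning
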